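{- Let $n$ be a positive integer with $\gcd(2,n)=1$ and let $k=2$. Then for every pair of distinct nonzero $v_1,v_2\in\mathbb{F}_{2^n}$, $$\bigl|\{(x,y,z)\in\Delta^3:\ v_1x+v_2y+(v_1+v_2)z=0\}\bigr|=2^{2n-3}.$$ Equivalently, for all $a,b\in\mathbb{F}_{2^n}\setminus\{0,1\}$ with $a^6+b^6=1$, the degree-$15$ polynomial $(a\tau^5+b)^3+(\tau^3+1)^5$ in $\tau$ has $\tau_0=a/b$ as its unique root in $\mathbb{F}_{2^n}$.
   Context: $\mathbb{F}_{2^n}$ is the field with $2^n$ elements. For $k=2$, $F(x)=x^{4^k-2^k+1}=x^{13}$ on $\mathbb{F}_{2^n}$, $\delta(b)=F(b)+F(b+1)+1$, and $\Delta=\{\delta(b): b\in\mathbb{F}_{2^n}\}$. -}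

module Defs where

open import Level using (Level; _⊔_)
open import Algebra.Apartness.Bundles using (HeytingField; HeytingCommutativeRing)
open import Algebra.Bundles using (CommutativeRing)
import Algebra.Properties.Semiring.Exp as Exp
open import Data.Fin.Base using (Fin)
open import Data.List.Base using (List; []; _∷_; map)
open import Data.Nat.Base as ℕ using (ℕ; zero; suc)
open import Data.Product.Base using (_×_; _,_; ∃-syntax; Σ; proj₁)
open import Data.Product.Relation.Binary.Pointwise.NonDependent using (×-setoid)
open import Function.Bundles using (Inverse)
open import Relation.Binary.Bundles using (Setoid)
import Relation.Binary.Construct.On as On
open import Relation.Binary.PropositionalEquality.Properties using () renaming (setoid to ≡-setoid)
open import Relation.Unary using (Pred)

private variable
  a ℓ p : Level

-- The subset {s ∈ S : P s}.  Elements are compared by their first component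
-- only, so different proofs of P do not count as different elements.
Subset : (S : Setoid a ℓ) → Pred (Setoid.Carrier S) p → Setoid (a ⊔ p) ℓ
Subset S P = On.setoid {B = Σ (Setoid.Carrier S) P} S proj₁

infix 4 _HasCardinality_

_HasCardinality_ : Setoid a ℓ → ℕ → Set (a ⊔ ℓ)
S HasCardinality m = Inverse (≡-setoid (Fin m)) S

-- Inequality in the field is expressed by the apartness x # y, i.e. by
-- invertibility of x - y.  Over a finite carrier this is decidable, and, the
-- apartness being tight, it is the same as ¬ (x ≈ y).
module FieldNotions {c ℓ₁ ℓ₂} (K : HeytingField c ℓ₁ ℓ₂) where

  open HeytingField K
  open CommutativeRing (HeytingCommutativeRing.commutativeRing heytingCommutativeRing)
    using (semiring)
  open Exp semiring public using (_^_)

  -- #⇒invertible yields the inverse of y - 0#, which is y up to _≈_.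
  divide : (x y : Carrier) → y # 0# → Carrier
  divide x y y#0 = x * proj₁ (#⇒invertible y#0)

  syntax divide x y y#0 = x / y [ y#0 ]

  module Kasami (k : ℕ) where

    F : Carrier → Carrier
    F x = x ^ (4 ℕ.^ k ℕ.∸ 2 ℕ.^ k ℕ.+ 1)

    δ : Carrier → Carrier
    δ b = F b + F (b + 1#) + 1#

    Δ : Pred Carrier (c ⊔ ℓ₁)
    Δ x = ∃[ b ] x ≈ δ b

    ΔTriples : (v₁ v₂ : Carrier) → Setoid (c ⊔ ℓ₁) ℓ₁
    ΔTriples v₁ v₂ = Subset (×-setoid setoid (×-setoid setoid setoid))
      λ (x , y , z) → (Δ x × Δ y × Δ z) × v₁ * x + v₂ * y + (v₁ + v₂) * z ≈ 0#

  module Polynomial where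

    -- Coefficients are listed from the constant term upwards; trailing zeros
    -- are allowed.
    Poly : Set c
    Poly = List Carrier

    coeff : Poly → ℕ → Carrier
    coeff []      _       = 0#
    coeff (r ∷ _) zero    = r
    coeff (_ ∷ f) (suc i) = coeff f i

    infixr 8 _^ₚ_
    infixl 7 _*ₚ_
    infixl 6 _+ₚ_

    const : Carrier → Poly
    const r = r ∷ []

    X : Poly
    X = 0# ∷ 1# ∷ []

    _+ₚ_ : Poly → Poly → Poly
    []      +ₚ g       = g
    (r ∷ f) +ₚ []      = r ∷ f
    (r ∷ f) +ₚ (s ∷ g) = (r + s) ∷ (f +ₚ g)

    _*ₚ_ : Poly → Poly → Poly
    []      *ₚ g = []
    (r ∷ f) *ₚ g = map (r *_) g +ₚ (0# ∷ (f *ₚ g))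

    _^ₚ_ : Poly → ℕ → Poly
    f ^ₚ zero  = const 1#
    f ^ₚ suc m = f *ₚ (f ^ₚ m)

    eval : Poly → Carrier → Carrier
    eval []      t = 0#
    eval (r ∷ f) t = r + t * eval f t

    HasDegree : Poly → ℕ → Set (ℓ₁ ⊔ ℓ₂)
    HasDegree f d = coeff f d # 0# × (∀ i → d ℕ.< i → coeff f i ≈ 0#)

    IsRoot : Poly → Pred Carrier ℓ₁
    IsRoot f t = eval f t ≈ 0#

    IsUniqueRoot : Poly → Pred Carrier (c ⊔ ℓ₁)
    IsUniqueRoot f t₀ = IsRoot f t₀ × (∀ t → IsRoot f t → t ≈ t₀)

{-# OPTIONS --safe #-}

-- Put g(r) = r⁶ + r⁵ and q = 2ⁿ.  Then δ(b) = g(b² + b + 1).  The points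
-- (1, r⁵, r⁶) form an arc (part of Segre's hyperoval), so g is two-to-one, and
-- r + r′ + 1 has the form u² + u whenever r ≠ r′ lie in one fibre; hence Δ is
-- the whole image of g.  Therefore 8 times the number of triples is the number
-- of zeros r of S₆ + S₅, where Sₖ(r) = v₁ r₁ᵏ + v₂ r₂ᵏ + (v₁ + v₂) r₃ᵏ.  By
-- homogeneity all the forms t S₆ + S₅ with t ≠ 0 have equally many zeros.
-- Both S₆ and S₅ have q² zeros, and by the arc property the q points of
-- r₁ = r₂ = r₃ are their only common ones, so double counting the pairs (t, r)
-- with t S₆(r) + S₅(r) = 0 gives q² zeros for each t.  A second root of the
-- polynomial of degree 15 would give a further common zero of S₆ and S₅ for the
-- coefficients a⁶, b⁶, 1.  That n is odd enters through the norm form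
-- x² + x y + y² of 𝔽₄, which is then anisotropic.
module Submission where

open import Defs
open import Level using (Level; _⊔_)
open import Algebra.Apartness.Bundles using (HeytingField; HeytingCommutativeRing)
open import Algebra.Bundles using (CommutativeMonoid; CommutativeRing)
open import Algebra.Bundles.Raw using (RawRing)
import Algebra.Solver.Ring as RingSolver
open import Algebra.Solver.Ring.AlmostCommutativeRing
  using (AlmostCommutativeRing; _-Raw-AlmostCommutative⟶_; fromCommutativeSemiring)
open import Data.Bool.Base using (Bool; true; false; _xor_; _∧_; if_then_else_)
open import Data.Bool.Properties using () renaming (_≟_ to _≟ᵇ_)
open import Data.Fin.Base using (Fin; zero; suc; combine; remQuot; punchOut; _↑ˡ_; _↑ʳ_)
open import Data.Fin.Permutation using (↔⇒≡)
import Data.Fin.Properties as Finₚ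
open import Data.List.Base using ([]; _∷_; map)
open import Data.Maybe.Base using (Maybe; just; nothing)
open import Data.Nat.Base as ℕ using (ℕ; zero; suc)
open import Data.Nat.Divisibility using (_∣_; divides; ∣1⇒≡1; ∣-refl)
open import Data.Nat.GCD using (gcd; gcd-greatest)
import Data.Nat.Properties as ℕₚ
import Data.Nat.Solver
open import Data.Product.Base using (_×_; _,_; ∃-syntax; Σ; proj₁; proj₂)
open import Data.Product.Function.NonDependent.Setoid using (_×-inverse_)
open import Data.Product.Relation.Binary.Pointwise.NonDependent using (×-setoid)
open import Data.Sum.Base using (_⊎_; inj₁; inj₂; [_,_]′)
open import Data.Vec.Functional using (Vector)
open import Function.Base using (_∘_; _∘′_)
open import Function.Bundles using (Inverse)
import Function.Construct.Composition as Compose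
import Function.Construct.Symmetry as Symmetry
open import Relation.Binary.Bundles using (Setoid)
open import Relation.Binary.Core using (_Preserves_⟶_)
open import Relation.Binary.Definitions using (Decidable; _Respects_)
open import Relation.Binary.PropositionalEquality.Core as ≡ using (_≡_; _≢_; cong; cong₂)
open import Relation.Binary.PropositionalEquality.Properties
  using (module ≡-Reasoning) renaming (setoid to ≡-setoid)
open import Relation.Nullary using (Dec; does; yes; no; ¬_; contradiction; _×-dec_)
open import Relation.Nullary.Decidable using (map′)
open import Relation.Unary using (Pred) renaming (Decidable to Decidable₁)

open import Algebra.Properties.Semiring.Sum ℕₚ.+-*-semiring
  using (sum; ∑-comm; sum-cong-≗; ∑-distrib-+; *-distribˡ-sum; *-distribʳ-sum)

-- The form u² + u is a trace condition: for odd n the elements b² + b + 1 are exactly those of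
-- trace 1, so the claim about r + r′ + 1 says that every fibre of g has one element of trace 1 and
-- one of trace 0. To prove it, the second point of a fibre is needed explicitly. Put r′ = r/(1 +
-- z). Once the trivial solution z = 0 is removed, g r′ = g r becomes (r + 1) D(z) = 1 with D(z) =
-- z⁵ + z³ + z, a Dickson polynomial that permutes the field for odd n. Anisotropy always enters in
-- the same way: x³ + y³, x⁵ + y⁵, D(x) + D(y) and the collinearity determinant are each a product
-- of differences and a value of the norm form. In particular fifth and sixth powers permute the
-- field, which is why S₅ and S₆ have q² zeros. In the double count a triple r with S₆(r) ≠ 0 admits
-- one t, a common zero admits all q, and the other zeros of S₆ admit none. This makes (q³ - q²) +
-- q·q = q³ pairs, to be compared with q² + (q - 1)A, where A is the number of zeros for each t ≠ 0.

module N = Data.Nat.Solver.+-*-Solver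

private variable
  a ℓ p : Level
  U V : Set a
  m n : ℕ
  S T : Setoid a ℓ

-- Finite sums and indicators

module _ {c ℓ} (M : CommutativeMonoid c ℓ) where
  open CommutativeMonoid M
  open import Algebra.Properties.CommutativeMonoid.Sum M
    renaming (sum to ⨁) using (sum-remove; sum-cong-≋; sum-replicate-zero)

  -- Stated for an arbitrary commutative monoid because it serves both the sums of natural numbers
  -- in the counts and the product over the field in `fermat`.
  sum-supported : ∀ {n} (t : Vector Carrier n) i → (∀ j → i ≢ j → t j ≈ ε) → ⨁ t ≈ t i
  sum-supported {suc n} t i t≈ε =
    trans (sum-remove {i = i} t)
      (trans (∙-congˡ (trans (sum-cong-≋ (λ j → t≈ε _ (Finₚ.punchInᵢ≢i i j ∘′ ≡.sym)))
                             (sum-replicate-zero n)))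
             (identityʳ _))

𝟙 : Dec U → ℕ
𝟙 d = if does d then 1 else 0

𝟙-yes : (d : Dec U) → U → 𝟙 d ≡ 1
𝟙-yes (yes _) _ = ≡.refl
𝟙-yes (no ¬a) a = contradiction a ¬a

𝟙-no : (d : Dec U) → ¬ U → 𝟙 d ≡ 0
𝟙-no (yes a) ¬a = contradiction a ¬a
𝟙-no (no _)  _  = ≡.refl

𝟙-cong : (d : Dec U) (e : Dec V) → (U → V) → (V → U) → 𝟙 d ≡ 𝟙 e
𝟙-cong (yes a) e f g = ≡.sym (𝟙-yes e (f a))
𝟙-cong (no ¬a) e f g = ≡.sym (𝟙-no e (¬a ∘′ g))

𝟙-× : (d : Dec U) (e : Dec V) → 𝟙 (d ×-dec e) ≡ 𝟙 d ℕ.* 𝟙 e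
𝟙-× (yes _) (yes _) = ≡.refl
𝟙-× (yes _) (no _)  = ≡.refl
𝟙-× (no _)  _       = ≡.refl

sum-+ : ∀ m {n} (t : Vector ℕ (m ℕ.+ n)) →
        sum t ≡ sum (t ∘ (_↑ˡ n)) ℕ.+ sum (t ∘ (m ↑ʳ_))
sum-+ zero    t = ≡.refl
sum-+ (suc m) t = ≡.trans (cong (t zero ℕ.+_) (sum-+ m (t ∘ suc))) (≡.sym (ℕₚ.+-assoc (t zero) _ _))

sum-combine : ∀ m {n} (t : Vector ℕ (m ℕ.* n)) →
              sum t ≡ sum (λ (i : Fin m) → sum (λ (j : Fin n) → t (combine i j)))
sum-combine zero        t = ≡.refl
sum-combine (suc m) {n} t = ≡.trans (sum-+ n t) (cong (sum (λ j → t (j ↑ˡ (m ℕ.* n))) ℕ.+_) (sum-combine m (t ∘ (n ↑ʳ_))))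

-- Cardinality and counting in finite setoids

infixr 4 _⟫_
_⟫_ : ∀ {c ℓ″} {U : Setoid c ℓ″} → Inverse S T → Inverse T U → Inverse S U
_⟫_ = Compose.inverse

HasCardinality-unique : S HasCardinality m → S HasCardinality n → m ≡ n
HasCardinality-unique f g = ↔⇒≡ (f ⟫ Symmetry.inverse g)

module FinSubset where

  to : {P : Pred (Fin n) p} (P? : Decidable₁ P) → Fin (sum (𝟙 ∘ P?)) → Σ (Fin n) P
  to {n = suc n} P? k with P? zero
  to {n = suc n} P? zero    | yes pz = zero , pz
  to {n = suc n} P? (suc k) | yes _  = let i , pi = to (P? ∘ suc) k in suc i , pi
  to {n = suc n} P? k       | no _   = let i , pi = to (P? ∘ suc) k in suc i , pi

  from : {P : Pred (Fin n) p} (P? : Decidable₁ P) → Σ (Fin n) P → Fin (sum (𝟙 ∘ P?))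
  from {n = suc n} P? (i , pi) with P? zero
  from {n = suc n} P? (zero  , _)  | yes _  = zero
  from {n = suc n} P? (zero  , pz) | no ¬pz = contradiction pz ¬pz
  from {n = suc n} P? (suc i , pi) | yes _  = suc (from (P? ∘ suc) (i , pi))
  from {n = suc n} P? (suc i , pi) | no _   = from (P? ∘ suc) (i , pi)

  from-cong : {P : Pred (Fin n) p} (P? : Decidable₁ P) {x y : Σ (Fin n) P} →
              proj₁ x ≡ proj₁ y → from P? x ≡ from P? y
  from-cong {n = suc n} P? {i , pi} {.i , qi} ≡.refl with P? zero
  from-cong {n = suc n} P? {zero , _}  ≡.refl | yes _  = ≡.refl
  from-cong {n = suc n} P? {zero , pz} ≡.refl | no ¬pz = contradiction pz ¬pz
  from-cong {n = suc n} P? {suc i , _} ≡.refl | yes _  = cong suc (from-cong (P? ∘ suc) ≡.refl)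
  from-cong {n = suc n} P? {suc i , _} ≡.refl | no _   = from-cong (P? ∘ suc) ≡.refl

  to-from : {P : Pred (Fin n) p} (P? : Decidable₁ P) (x : Σ (Fin n) P) →
            proj₁ (to P? (from P? x)) ≡ proj₁ x
  to-from {n = suc n} P? (i , pi) with P? zero
  to-from {n = suc n} P? (zero  , _)  | yes _  = ≡.refl
  to-from {n = suc n} P? (zero  , pz) | no ¬pz = contradiction pz ¬pz
  to-from {n = suc n} P? (suc i , pi) | yes _  = cong suc (to-from (P? ∘ suc) (i , pi))
  to-from {n = suc n} P? (suc i , pi) | no _   = cong suc (to-from (P? ∘ suc) (i , pi))

  from-to : {P : Pred (Fin n) p} (P? : Decidable₁ P) (k : Fin (sum (𝟙 ∘ P?))) →
            from P? (to P? k) ≡ k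
  from-to {n = suc n} P? k with P? zero
  from-to {n = suc n} P? zero    | yes _ = ≡.refl
  from-to {n = suc n} P? (suc k) | yes _ = cong suc (from-to (P? ∘ suc) k)
  from-to {n = suc n} P? k       | no _  = from-to (P? ∘ suc) k

  -- The bridge between two notions of size: bijections with `Fin`, in which the theorem is stated,
  -- and sums of indicators, in which the double counts are carried out.
  hasCardinality : {P : Pred (Fin n) p} (P? : Decidable₁ P) →
                   Subset (≡-setoid (Fin n)) P HasCardinality sum (𝟙 ∘ P?)
  hasCardinality P? = record
    { to        = to P?
    ; from      = from P?
    ; to-cong   = λ { ≡.refl → ≡.refl }
    ; from-cong = from-cong P?
    ; inverse   = (λ {x} eq → ≡.trans (cong (proj₁ ∘ to P?) eq) (to-from P? x))
                , (λ {k} eq → ≡.trans (from-cong P? eq) (from-to P? k))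
    }

module Enumerated {S : Setoid a ℓ} {N : ℕ} (fin : S HasCardinality N) where
  open Setoid S
  open Inverse fin using (to; from; from-cong; strictlyInverseˡ; strictlyInverseʳ)
  open Inverse using () renaming (to to _⟨$⟩_)

  infix 4 _≟_
  abstract
    _≟_ : Decidable _≈_
    x ≟ y = map′ (λ eq → trans (sym (strictlyInverseˡ x)) (trans (Inverse.to-cong fin eq) (strictlyInverseˡ y)))
                 from-cong (from x Finₚ.≟ from y)

    any? : {P : Pred Carrier p} → P Respects _≈_ → Decidable₁ P → Dec (∃[ x ] P x)
    any? resp P? = map′ (λ (i , pi) → to i , pi) (λ (x , px) → from x , resp (sym (strictlyInverseˡ x)) px)
                        (Finₚ.any? (P? ∘ to))

  ∑ : (Carrier → ℕ) → ℕ
  ∑ f = sum (f ∘ to)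

  ∑-cong : {f g : Carrier → ℕ} → (∀ x → f x ≡ g x) → ∑ f ≡ ∑ g
  ∑-cong f≗g = sum-cong-≗ (f≗g ∘ to)

  module _ {c ℓ′} (M : CommutativeMonoid c ℓ′) where
    private module M = CommutativeMonoid M
    open import Algebra.Properties.CommutativeMonoid.Sum M
      renaming (sum to ⨁) using (sum-permute; sum-cong-≋)

    -- Conjugation by the enumeration turns `π` into a permutation of `Fin N`. It is applied to
    -- translation by 1, to multiplication by a nonzero scalar and to the scaling of triples.
    sum-reindex : (π : Inverse S S) {f : Carrier → M.Carrier} → f Preserves _≈_ ⟶ M._≈_ →
                  ⨁ (f ∘ to) M.≈ ⨁ (f ∘ (π ⟨$⟩_) ∘ to)
    sum-reindex π {f} f-cong = M.trans (sum-permute (f ∘ to) (fin ⟫ π ⟫ Symmetry.inverse fin))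
                                       (sum-cong-≋ (λ i → f-cong (strictlyInverseˡ (π ⟨$⟩ to i))))

  ∑-+ : (f g : Carrier → ℕ) → ∑ (λ x → f x ℕ.+ g x) ≡ ∑ f ℕ.+ ∑ g
  ∑-+ f g = ∑-distrib-+ (f ∘ to) (g ∘ to)

  *-∑ : ∀ k (f : Carrier → ℕ) → ∑ (λ x → k ℕ.* f x) ≡ k ℕ.* ∑ f
  *-∑ k f = ≡.sym (*-distribˡ-sum k (f ∘ to))

  ∑-* : (f : Carrier → ℕ) → ∀ k → ∑ (λ x → f x ℕ.* k) ≡ ∑ f ℕ.* k
  ∑-* f k = ≡.sym (*-distribʳ-sum k (f ∘ to))

  ∑-const : ∀ k → ∑ (λ _ → k) ≡ N ℕ.* k
  ∑-const k = lemma N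
    where
    lemma : ∀ n → sum {n} (λ _ → k) ≡ n ℕ.* k
    lemma zero    = ≡.refl
    lemma (suc n) = cong (k ℕ.+_) (lemma n)

  ∑-𝟙-≈ : (f : Carrier → ℕ) → f Preserves _≈_ ⟶ _≡_ → ∀ c → ∑ (λ x → 𝟙 (c ≟ x) ℕ.* f x) ≡ f c
  ∑-𝟙-≈ f f-cong c = begin
    sum t                                  ≡⟨ sum-supported ℕₚ.+-0-commutativeMonoid t (from c) vanish ⟩
    𝟙 (c ≟ to (from c)) ℕ.* f (to (from c)) ≡⟨ cong₂ ℕ._*_ (𝟙-yes (c ≟ _) (sym (strictlyInverseˡ c)))
                                                           (f-cong (strictlyInverseˡ c)) ⟩
    1 ℕ.* f c                              ≡⟨ ℕₚ.*-identityˡ (f c) ⟩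
    f c                                    ∎
    where
    open ≡-Reasoning
    t : Vector ℕ N
    t i = 𝟙 (c ≟ to i) ℕ.* f (to i)
    vanish : ∀ i → from c ≢ i → t i ≡ 0
    vanish i fc≢i = cong (ℕ._* f (to i))
      (𝟙-no (c ≟ to i) λ c≈ → fc≢i (≡.trans (from-cong c≈) (strictlyInverseʳ i)))

  count : {P : Pred Carrier p} → Decidable₁ P → ℕ
  count P? = ∑ (𝟙 ∘ P?)

  count-≈ : ∀ c → count (c ≟_) ≡ 1
  count-≈ c = ≡.trans (∑-cong λ x → ≡.sym (ℕₚ.*-identityʳ (𝟙 (c ≟ x)))) (∑-𝟙-≈ (λ _ → 1) (λ _ → ≡.refl) c)

  subset-hasCardinality : {P : Pred Carrier p} → P Respects _≈_ → (P? : Decidable₁ P) →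
                          Subset S P HasCardinality count P?
  subset-hasCardinality {P = P} resp P? = FinSubset.hasCardinality (P? ∘ to) ⟫ record
    { to        = λ (i , pi) → to i , pi
    ; from      = λ (x , px) → from x , resp (sym (strictlyInverseˡ x)) px
    ; to-cong   = Inverse.to-cong fin
    ; from-cong = from-cong
    ; inverse   = (λ eq → Inverse.inverseˡ fin eq) , (λ eq → Inverse.inverseʳ fin eq)
    }

  count-card : {P : Pred Carrier p} → P Respects _≈_ → (P? : Decidable₁ P) →
               ∀ {m} → Subset S P HasCardinality m → count P? ≡ m
  count-card resp P? = HasCardinality-unique (subset-hasCardinality resp P?)

  -- A preimage is found by search. If the search failed, punching out the missed value would inject
  -- a finite set into a smaller one. All roots and preimages under permutation polynomials come
  -- from here.
  injective⇒surjective : (f : Carrier → Carrier) → f Preserves _≈_ ⟶ _≈_ →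
                         (∀ {x y} → f x ≈ f y → x ≈ y) → ∀ y → ∃[ x ] f x ≈ y
  injective⇒surjective f f-cong f-inj y with any? (λ x≈x′ fx≈y → trans (f-cong (sym x≈x′)) fx≈y) (λ x → f x ≟ y)
  ... | yes hit = hit
  ... | no miss = contradiction (from y) (avoid (from y) φ φ-inj φ-miss)
    where
    φ : Fin N → Fin N
    φ = from ∘ f ∘ to
    φ-inj : ∀ {i j} → φ i ≡ φ j → i ≡ j
    φ-inj {i} {j} eq = ≡.trans (≡.sym (strictlyInverseʳ i)) (≡.trans (from-cong (f-inj
      (trans (sym (strictlyInverseˡ _)) (trans (Inverse.to-cong fin eq) (strictlyInverseˡ _))))) (strictlyInverseʳ j))
    φ-miss : ∀ i → from y ≢ φ i
    φ-miss i eq = miss (to i , trans (sym (strictlyInverseˡ _))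
      (trans (Inverse.to-cong fin (≡.sym eq)) (strictlyInverseˡ y)))
    avoid : ∀ {n} (k : Fin n) (φ : Fin n → Fin n) → (∀ {i j} → φ i ≡ φ j → i ≡ j) → (∀ i → k ≢ φ i) → ¬ Fin n
    avoid {suc n} k φ inj k≢φ _ = ℕₚ.1+n≰n (Finₚ.injective⇒≤ {f = λ i → punchOut (k≢φ i)}
      λ {i} {j} eq → inj (Finₚ.punchOut-injective (k≢φ i) (k≢φ j) eq))

×-hasCardinality : S HasCardinality m → T HasCardinality n → ×-setoid S T HasCardinality (m ℕ.* n)
×-hasCardinality {S = S} {m = m} {T = T} {n = n} fS fT = record
  { to        = λ k → let i , j = remQuot {m} n k in to fS i , to fT j
  ; from      = λ (x , y) → combine (from fS x) (from fT y)
  ; to-cong   = λ { ≡.refl → Setoid.refl S , Setoid.refl T }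
  ; from-cong = λ (eq₁ , eq₂) → cong₂ combine (Inverse.from-cong fS eq₁) (Inverse.from-cong fT eq₂)
  ; inverse   = (λ { {x , y} ≡.refl → ×-inverseˡ x y })
              , (λ { {k} (eq₁ , eq₂) → ≡.trans
                  (cong₂ combine (Inverse.inverseʳ fS eq₁) (Inverse.inverseʳ fT eq₂))
                  (Finₚ.combine-remQuot {m} n k) })
  }
  where
  open Inverse using (to; from)
  ×-inverseˡ : ∀ x y → let i , j = remQuot {m} n (combine (from fS x) (from fT y)) in
               Setoid._≈_ (×-setoid S T) (to fS i , to fT j) (x , y)
  ×-inverseˡ x y =
    Setoid.trans S (Setoid.reflexive S (cong (to fS ∘′ proj₁) eq)) (Inverse.strictlyInverseˡ fS x) ,
    Setoid.trans T (Setoid.reflexive T (cong (to fT ∘′ proj₂) eq)) (Inverse.strictlyInverseˡ fT y)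
    where eq = Finₚ.remQuot-combine (from fS x) (from fT y)

module _ where
  open Enumerated using (∑)

  ∑-swap : (fS : S HasCardinality m) (fT : T HasCardinality n) (f : Setoid.Carrier S → Setoid.Carrier T → ℕ) →
           ∑ fS (λ x → ∑ fT (f x)) ≡ ∑ fT (λ y → ∑ fS (λ x → f x y))
  ∑-swap fS fT f = ∑-comm (λ i j → f (Inverse.to fS i) (Inverse.to fT j))

  -- Each term is expanded over the indicator of its image, and the two summations are exchanged.
  ∑-fibres : (fS : S HasCardinality m) (fT : T HasCardinality n) →
             let open Enumerated fT using (_≟_) in
             (φ : Setoid.Carrier S → Setoid.Carrier T) (f : Setoid.Carrier T → ℕ) →
             f Preserves (Setoid._≈_ T) ⟶ _≡_ →
             ∑ fS (f ∘ φ) ≡ ∑ fT (λ y → ∑ fS (λ x → 𝟙 (φ x ≟ y)) ℕ.* f y)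
  ∑-fibres fS fT φ f f-cong = begin
    ∑ fS (f ∘ φ)                                       ≡⟨ FS.∑-cong (λ x → ≡.sym (FT.∑-𝟙-≈ f f-cong (φ x))) ⟩
    ∑ fS (λ x → ∑ fT (λ y → 𝟙 (φ x FT.≟ y) ℕ.* f y))   ≡⟨ ∑-swap fS fT (λ x y → 𝟙 (φ x FT.≟ y) ℕ.* f y) ⟩
    ∑ fT (λ y → ∑ fS (λ x → 𝟙 (φ x FT.≟ y) ℕ.* f y))   ≡⟨ FT.∑-cong (λ y → FS.∑-* (λ x → 𝟙 (φ x FT.≟ y)) (f y)) ⟩
    ∑ fT (λ y → ∑ fS (λ x → 𝟙 (φ x FT.≟ y)) ℕ.* f y)   ∎
    where
    open ≡-Reasoning
    module FS = Enumerated fS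
    module FT = Enumerated fT

  ∑-× : (fS : S HasCardinality m) (fT : T HasCardinality n) (f : Setoid.Carrier S × Setoid.Carrier T → ℕ) →
        ∑ (×-hasCardinality fS fT) f ≡ ∑ fS (λ x → ∑ fT (λ y → f (x , y)))
  ∑-× {m = m} fS fT f = ≡.trans (sum-combine m _)
    (sum-cong-≗ λ i → sum-cong-≗ λ j → cong (λ (k , l) → f (Inverse.to fS k , Inverse.to fT l)) (Finₚ.remQuot-combine i j))

-- Polynomial identities in characteristic two

𝔽₂ : RawRing _ _
𝔽₂ = record { Carrier = Bool ; _≈_ = _≡_ ; _+_ = _xor_ ; _*_ = _∧_ ; -_ = λ x → x ; 0# = false ; 1# = true }

HasCharacteristicTwo : ∀ {c ℓ} → CommutativeRing c ℓ → Set ℓ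
HasCharacteristicTwo R = 1# + 1# ≈ 0#
  where open CommutativeRing R

module CharacteristicTwo {c ℓ} (R : CommutativeRing c ℓ)
  (1+1≈0 : HasCharacteristicTwo R) where
  open CommutativeRing R

  private
    almost : AlmostCommutativeRing c ℓ
    almost = fromCommutativeSemiring commutativeSemiring

    ⟦_⟧ᵇ : Bool → Carrier
    ⟦ true  ⟧ᵇ = 1#
    ⟦ false ⟧ᵇ = 0#

    +-homo : ∀ x y → ⟦ x xor y ⟧ᵇ ≈ ⟦ x ⟧ᵇ + ⟦ y ⟧ᵇ
    +-homo true  true  = sym 1+1≈0
    +-homo true  false = sym (+-identityʳ 1#)
    +-homo false y     = sym (+-identityˡ ⟦ y ⟧ᵇ)

    *-homo : ∀ x y → ⟦ x ∧ y ⟧ᵇ ≈ ⟦ x ⟧ᵇ * ⟦ y ⟧ᵇ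
    *-homo true  y = sym (*-identityˡ ⟦ y ⟧ᵇ)
    *-homo false y = sym (zeroˡ ⟦ y ⟧ᵇ)

    morphism : 𝔽₂ -Raw-AlmostCommutative⟶ almost
    morphism = record
      { ⟦_⟧ = ⟦_⟧ᵇ ; +-homo = +-homo ; *-homo = *-homo ; -‿homo = λ _ → refl ; 0-homo = refl ; 1-homo = refl }

    weakly : ∀ x y → Maybe (⟦ x ⟧ᵇ ≈ ⟦ y ⟧ᵇ)
    weakly x y with x ≟ᵇ y
    ... | yes ≡.refl = just refl
    ... | no _       = nothing

  -- With coefficients in 𝔽₂ the solver cancels equal terms in pairs, so it proves identities that
  -- hold only modulo 2.
  open RingSolver 𝔽₂ almost morphism weakly public
    using (Polynomial; solve; _:=_; _:+_; _:*_; _:^_; con)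

  open import Algebra.Properties.Semiring.Exp semiring using (_^_)

  :norm : ∀ {k} → Polynomial k → Polynomial k → Polynomial k
  :norm x y = x :^ 2 :+ x :* y :+ y :^ 2

  norm : Carrier → Carrier → Carrier
  norm x y = x ^ 2 + x * y + y ^ 2

  -- With ω a primitive cube root of unity, the quartic (x⁵ + y⁵)/(x + y) splits over 𝔽₄ into x y +
  -- ω (x² + y²) and its conjugate, hence it is a norm.
  fifth-factors : ∀ x y → (x + y) * norm (x * y) (x ^ 2 + y ^ 2) ≈ x ^ 5 + y ^ 5
  fifth-factors = solve 2 (λ x y →
    (x :+ y) :* :norm (x :* y) (x :^ 2 :+ y :^ 2) := x :^ 5 :+ y :^ 5) refl

  -- The Dickson polynomial D₅(x, 1) = x⁵ - 5x³ + 5x reduced modulo 2. It permutes the field of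
  -- order q exactly when 5 is prime to q² - 1, that is, when n is odd.
  dickson : Carrier → Carrier
  dickson x = x ^ 5 + x ^ 3 + x

  dickson-factors : ∀ x y → (x + y) * norm (x * y + 1#) (x ^ 2 + y ^ 2 + 1#) ≈ dickson x + dickson y
  dickson-factors = solve 2 (λ x y →
    (x :+ y) :* :norm (x :* y :+ con true) (x :^ 2 :+ y :^ 2 :+ con true) :=
    (x :^ 5 :+ x :^ 3 :+ x) :+ (y :^ 5 :+ y :^ 3 :+ y)) refl

  -- The left side is the alternant with exponents 0, 5, 6. Its quotient by the Vandermonde product
  -- is the Schur polynomial of the partition (4, 4), which modulo 2 equals e₂⁴ + e₂² e₁ e₃ + (e₁
  -- e₃)² in the elementary symmetric functions.
  collinear-factors : ∀ x y z →
    (x ^ 6 + z ^ 6) * (y ^ 5 + z ^ 5) + (y ^ 6 + z ^ 6) * (x ^ 5 + z ^ 5) ≈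
    (x + y) * (y + z) * (x + z) * norm ((x * y + y * z + z * x) ^ 2) (x * y * z * (x + y + z))
  collinear-factors = solve 3 (λ x y z →
    (x :^ 6 :+ z :^ 6) :* (y :^ 5 :+ z :^ 5) :+ (y :^ 6 :+ z :^ 6) :* (x :^ 5 :+ z :^ 5) :=
    (x :+ y) :* (y :+ z) :* (x :+ z) :*
      :norm ((x :* y :+ y :* z :+ z :* x) :^ 2) (x :* y :* z :* (x :+ y :+ z))) refl

-- Finite fields of order 2ⁿ

double : ℕ → ℕ
double zero    = zero
double (suc m) = suc (suc (double m))

-- Inequality is negated equality here: the counting argument decides equality on a finite carrier,
-- and the apartness of the theorem is translated only once, at the end.
record IsFiniteField {c ℓ} (R : CommutativeRing c ℓ) (n : ℕ) : Set (c ⊔ ℓ) where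
  open CommutativeRing R hiding (zero)
  field
    1≉0         : ¬ 1# ≈ 0#
    invert      : ∀ {x} → ¬ x ≈ 0# → ∃[ y ] y * x ≈ 1#
    cardinality : setoid HasCardinality (2 ℕ.^ n)

module FiniteField {c ℓ} {R : CommutativeRing c ℓ} {n : ℕ} (isField : IsFiniteField R n) where
  open CommutativeRing R hiding (zero)
  open IsFiniteField isField public
  open Enumerated cardinality public
  open import Algebra.Properties.Semiring.Exp semiring using (_^_; ^-congˡ; ^-assocʳ)
  open import Algebra.Properties.Semiring.Mult semiring using (×1-homo-*) renaming (_×_ to _·_)
  open import Algebra.Properties.CommutativeMonoid.Sum +-commutativeMonoid
    using () renaming (sum to ⨁; ∑-distrib-+ to ⨁-distrib-+; sum-replicate to ⨁-replicate)
  open import Algebra.Properties.CommutativeMonoid.Sum *-commutativeMonoid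
    using () renaming (sum to ∏; ∑-distrib-+ to ∏-distrib-*; sum-replicate to ∏-replicate; sum-cong-≋ to ∏-cong)
  open import Relation.Binary.Reasoning.Setoid setoid
  open Inverse cardinality using (to; from; strictlyInverseˡ; from-cong; strictlyInverseʳ)

  *-cancelˡ-≈0 : ∀ {x y} → ¬ x ≈ 0# → x * y ≈ 0# → y ≈ 0#
  *-cancelˡ-≈0 {x} {y} x≉0 xy≈0 with x⁻¹ , x⁻¹x≈1 ← invert x≉0 = begin
    y              ≈⟨ *-identityˡ y ⟨
    1# * y         ≈⟨ *-congʳ x⁻¹x≈1 ⟨
    x⁻¹ * x * y    ≈⟨ *-assoc x⁻¹ x y ⟩
    x⁻¹ * (x * y)  ≈⟨ *-congˡ xy≈0 ⟩
    x⁻¹ * 0#       ≈⟨ zeroʳ x⁻¹ ⟩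
    0#             ∎

  *-≉0 : ∀ {x y} → ¬ x ≈ 0# → ¬ y ≈ 0# → ¬ x * y ≈ 0#
  *-≉0 x≉0 y≉0 = y≉0 ∘′ *-cancelˡ-≈0 x≉0

  integral : ∀ x y → x * y ≈ 0# → x ≈ 0# ⊎ y ≈ 0#
  integral x y xy≈0 with x ≟ 0#
  ... | yes x≈0 = inj₁ x≈0
  ... | no  x≉0 = inj₂ (*-cancelˡ-≈0 x≉0 xy≈0)

  translation : Carrier → Inverse setoid setoid
  translation t = record
    { to        = _+ t
    ; from      = _- t
    ; to-cong   = +-congʳ
    ; from-cong = +-congʳ
    ; inverse   = (λ eq → trans (+-congʳ eq) (trans (+-assoc _ _ _) (trans (+-congˡ (-‿inverseˡ t)) (+-identityʳ _))))
                , (λ eq → trans (+-congʳ eq) (trans (+-assoc _ _ _) (trans (+-congˡ (-‿inverseʳ t)) (+-identityʳ _))))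
    }

  scaling : ∀ {x} → ¬ x ≈ 0# → Inverse setoid setoid
  scaling {x} x≉0 with x⁻¹ , x⁻¹x≈1 ← invert x≉0 = record
    { to        = x *_
    ; from      = x⁻¹ *_
    ; to-cong   = *-congˡ
    ; from-cong = *-congˡ
    ; inverse   = (λ eq → trans (*-congˡ eq) (trans (sym (*-assoc _ _ _))
                    (trans (*-congʳ (trans (*-comm x x⁻¹) x⁻¹x≈1)) (*-identityˡ _))))
                , (λ eq → trans (*-congˡ eq) (trans (sym (*-assoc _ _ _)) (trans (*-congʳ x⁻¹x≈1) (*-identityˡ _))))
    }

  -- Translating all summands of the sum over the whole field by 1 does not
  -- change it, so 2ⁿ vanishes.
  2ⁿ·1≈0 : (2 ℕ.^ n) · 1# ≈ 0#
  2ⁿ·1≈0 = identityʳ-unique (⨁ to) _ (begin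
    ⨁ to + (2 ℕ.^ n) · 1#             ≈⟨ +-congˡ (⨁-replicate (2 ℕ.^ n)) ⟨
    ⨁ to + ⨁ {2 ℕ.^ n} (λ _ → 1#)     ≈⟨ ⨁-distrib-+ {2 ℕ.^ n} to (λ _ → 1#) ⟨
    ⨁ (λ i → to i + 1#)               ≈⟨ sum-reindex +-commutativeMonoid (translation 1#) (λ eq → eq) ⟨
    ⨁ to                              ∎)
    where open import Algebra.Properties.Group +-group using (identityʳ-unique)

  -- The characteristic follows from the cardinality: 2ⁿ · 1 is a product of n factors 2 · 1, and
  -- there are no zero divisors.
  1+1≈0 : 1# + 1# ≈ 0#
  1+1≈0 = trans (+-congˡ (sym (+-identityʳ 1#))) (2·1≈0 n 2ⁿ·1≈0)
    where
    2·1≈0 : ∀ k → (2 ℕ.^ k) · 1# ≈ 0# → 2 · 1# ≈ 0#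
    2·1≈0 zero    eq = contradiction (trans (sym (+-identityʳ 1#)) eq) 1≉0
    2·1≈0 (suc k) eq = [ (λ z → z) , 2·1≈0 k ]′
      (integral (2 · 1#) ((2 ℕ.^ k) · 1#) (trans (sym (×1-homo-* 2 (2 ℕ.^ k))) eq))

  open CharacteristicTwo R 1+1≈0 public

  ∏-≉0 : ∀ {k} (t : Vector Carrier k) → (∀ i → ¬ t i ≈ 0#) → ¬ ∏ t ≈ 0#
  ∏-≉0 {zero}  t t≉0 = 1≉0
  ∏-≉0 {suc k} t t≉0 = *-≉0 (t≉0 zero) (∏-≉0 (t ∘ suc) (t≉0 ∘ suc))

  +≈0⇒≈ : ∀ {x y} → x + y ≈ 0# → x ≈ y
  +≈0⇒≈ {x} {y} eq = begin
    x             ≈⟨ solve 2 (λ x y → x := (x :+ y) :+ y) refl x y ⟩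
    (x + y) + y   ≈⟨ +-congʳ eq ⟩
    0# + y        ≈⟨ +-identityˡ y ⟩
    y             ∎

  ≈⇒+≈0 : ∀ {x y} → x ≈ y → x + y ≈ 0#
  ≈⇒+≈0 {x} {y} eq = trans (+-congʳ eq) (solve 1 (λ y → y :+ y := con false) refl y)

  *-≈0 : ∀ x {y} → y ≈ 0# → x * y ≈ 0#
  *-≈0 x eq = trans (*-congˡ eq) (zeroʳ x)

  +-≈0 : ∀ {x y} → x ≈ 0# → y ≈ 0# → x + y ≈ 0#
  +-≈0 x≈0 y≈0 = trans (+-cong x≈0 y≈0) (+-identityʳ 0#)

  *-cancelˡ-≈ : ∀ {x y z} → ¬ x ≈ 0# → x * y ≈ x * z → y ≈ z
  *-cancelˡ-≈ {x} {y} {z} x≉0 eq = +≈0⇒≈ (*-cancelˡ-≈0 x≉0 (trans (distribˡ x y z) (≈⇒+≈0 eq)))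

  -- For x ≠ 0, multiplication by x permutes the field, so the product of suitably modified elements
  -- can be compared before and after.
  fermat : ∀ x → x ^ (2 ℕ.^ n) ≈ x
  fermat x with x ≟ 0#
  ... | yes x≈0 = trans (^-congˡ (2 ℕ.^ n) x≈0) (trans (0^ n) (sym x≈0))
    where
    0^ : ∀ k → 0# ^ (2 ℕ.^ k) ≈ 0#
    0^ zero    = *-identityʳ 0#
    0^ (suc k) = trans (sym (^-assocʳ 0# 2 (2 ℕ.^ k))) (trans (^-congˡ (2 ℕ.^ k) (zeroˡ _)) (0^ k))
  ... | no  x≉0 = *-cancelˡ-≈ W≉0 (begin
    W * x ^ (2 ℕ.^ n)                       ≈⟨ *-comm W _ ⟩
    x ^ (2 ℕ.^ n) * W                       ≈⟨ *-congʳ (∏-replicate (2 ℕ.^ n)) ⟨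
    ∏ {2 ℕ.^ n} (λ _ → x) * W               ≈⟨ ∏-distrib-* {2 ℕ.^ n} (λ _ → x) (h ∘ to) ⟨
    ∏ (λ i → x * h (to i))                  ≈⟨ ∏-cong (λ i → x*h (to i)) ⟩
    ∏ (λ i → h (x * to i) * d (to i))       ≈⟨ ∏-distrib-* (λ i → h (x * to i)) (d ∘ to) ⟩
    ∏ (λ i → h (x * to i)) * ∏ (d ∘ to)     ≈⟨ *-cong (sym (sum-reindex *-commutativeMonoid (scaling x≉0) h-cong)) ∏d ⟩
    W * x                                   ∎)
    where
    -- `h` replaces 0 by 1, which keeps the product `W` over the whole field nonzero. The price is a
    -- single discrepancy at y = 0, where x * h y = x but h (x * y) = 1; `d` records it, and its
    -- product is x. So the exponent is 2ⁿ at once.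
    h d : Carrier → Carrier
    h y = if does (y ≟ 0#) then 1# else y
    d y = if does (y ≟ 0#) then x else 1#
    W : Carrier
    W = ∏ (h ∘ to)
    h≉0 : ∀ y → ¬ h y ≈ 0#
    h≉0 y with y ≟ 0#
    ... | yes _   = 1≉0
    ... | no  y≉0 = y≉0
    W≉0 : ¬ W ≈ 0#
    W≉0 = ∏-≉0 (h ∘ to) (h≉0 ∘ to)
    h-cong : h Preserves _≈_ ⟶ _≈_
    h-cong {y} {z} y≈z with y ≟ 0# | z ≟ 0#
    ... | yes _   | yes _   = refl
    ... | yes y≈0 | no  z≉0 = contradiction (trans (sym y≈z) y≈0) z≉0
    ... | no  y≉0 | yes z≈0 = contradiction (trans y≈z z≈0) y≉0
    ... | no  _   | no  _   = y≈z
    x*h : ∀ y → x * h y ≈ h (x * y) * d y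
    x*h y with y ≟ 0# | x * y ≟ 0#
    ... | yes _   | yes _    = *-comm x 1#
    ... | yes y≈0 | no  xy≉0 = contradiction (*-≈0 x y≈0) xy≉0
    ... | no  y≉0 | yes xy≈0 = contradiction (*-cancelˡ-≈0 x≉0 xy≈0) y≉0
    ... | no  _   | no  _    = sym (*-identityʳ _)
    ∏d : ∏ (d ∘ to) ≈ x
    ∏d = trans (sum-supported *-commutativeMonoid (d ∘ to) (from 0#) d≈1) d0
      where
      d≈1 : ∀ j → ¬ from 0# ≡ j → d (to j) ≈ 1#
      d≈1 j ≢ with to j ≟ 0#
      ... | yes ≈0 = contradiction (≡.trans (from-cong (sym ≈0)) (strictlyInverseʳ j)) ≢
      ... | no  _  = refl
      d0 : d (to (from 0#)) ≈ x
      d0 with to (from 0#) ≟ 0#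
      ... | yes _ = refl
      ... | no ≉0 = contradiction (strictlyInverseˡ 0#) ≉0

-- Odd degree: anisotropic norm, permutation polynomials and the arc

module OddDegree {c ℓ} {R : CommutativeRing c ℓ} {m : ℕ} (isField : IsFiniteField R (suc (double m))) where
  open CommutativeRing R hiding (zero)
  open FiniteField isField public
  open import Algebra.Properties.Semiring.Exp semiring using (_^_; ^-congˡ; ^-assocʳ)
  open import Relation.Binary.Reasoning.Setoid setoid

  frob : ℕ → Carrier → Carrier
  frob k x = x ^ (2 ℕ.^ k)

  frob-suc : ∀ k x → frob (suc k) x ≈ frob k x ^ 2
  frob-suc k x = begin
    x ^ (2 ℕ.* 2 ℕ.^ k)   ≡⟨ cong (x ^_) (ℕₚ.*-comm 2 (2 ℕ.^ k)) ⟩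
    x ^ (2 ℕ.^ k ℕ.* 2)   ≈⟨ ^-assocʳ x (2 ℕ.^ k) 2 ⟨
    frob k x ^ 2          ∎

  -- w² + w + 1 = 0 gives w⁴ = w, hence w^(2ⁿ) = w² ≠ w for odd n.
  no-cube-root-of-unity : ∀ w → ¬ w ^ 2 + w + 1# ≈ 0#
  no-cube-root-of-unity w eq = 1≉0 (begin
    1#                             ≈⟨ solve 1 (λ w → con true := (w :^ 2 :+ w :+ con true) :+ (w :^ 2 :+ w)) refl w ⟩
    (w ^ 2 + w + 1#) + (w ^ 2 + w) ≈⟨ +-≈0 eq (≈⇒+≈0 w²≈w) ⟩
    0#                             ∎)
    where
    even : ∀ k → frob (double k) w ≈ w
    even zero    = *-identityʳ w
    even (suc k) = begin
      frob (suc (suc (double k))) w   ≈⟨ frob-suc (suc (double k)) w ⟩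
      frob (suc (double k)) w ^ 2     ≈⟨ ^-congˡ 2 (frob-suc (double k) w) ⟩
      (frob (double k) w ^ 2) ^ 2     ≈⟨ ^-congˡ 2 (^-congˡ 2 (even k)) ⟩
      (w ^ 2) ^ 2                     ≈⟨ solve 1 (λ w → (w :^ 2) :^ 2 :=
                                           w :+ (w :^ 2 :+ w) :* (w :^ 2 :+ w :+ con true)) refl w ⟩
      w + (w ^ 2 + w) * (w ^ 2 + w + 1#) ≈⟨ +-congˡ (*-≈0 _ eq) ⟩
      w + 0#                          ≈⟨ +-identityʳ w ⟩
      w                               ∎
    w²≈w : w ^ 2 ≈ w
    w²≈w = begin
      w ^ 2                        ≈⟨ ^-congˡ 2 (even m) ⟨
      frob (double m) w ^ 2        ≈⟨ frob-suc (double m) w ⟨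
      frob (suc (double m)) w      ≈⟨ fermat w ⟩
      w                            ∎

  -- norm is the norm form of 𝔽₄, which does not embed into 𝔽_{2ⁿ} for odd n.
  norm-anisotropic : ∀ x y → norm x y ≈ 0# → x ≈ 0# × y ≈ 0#
  norm-anisotropic x y eq with y ≟ 0#
  ... | yes y≈0 = square-≈0 (begin
    x * x                                     ≈⟨ solve 2 (λ x y → x :* x :=
                                                    (x :^ 2 :+ x :* y :+ y :^ 2) :+ (x :+ y) :* y) refl x y ⟩
    (x ^ 2 + x * y + y ^ 2) + (x + y) * y     ≈⟨ +-≈0 eq (*-≈0 (x + y) y≈0) ⟩
    0#                                        ∎) , y≈0
    where
    square-≈0 : x * x ≈ 0# → x ≈ 0#
    square-≈0 = [ (λ z → z) , (λ z → z) ]′ ∘′ integral x x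
  ... | no y≉0 with z , zy≈1 ← invert y≉0 = contradiction (begin
    (x * z) ^ 2 + x * z + 1#
      ≈⟨ solve 3 (λ x y z → (x :* z) :^ 2 :+ x :* z :+ con true :=
           z :^ 2 :* (x :^ 2 :+ x :* y :+ y :^ 2) :+ (x :* z :+ z :* y :+ con true) :* (z :* y :+ con true))
         refl x y z ⟩
    z ^ 2 * (x ^ 2 + x * y + y ^ 2) + (x * z + z * y + 1#) * (z * y + 1#)
      ≈⟨ +-≈0 (*-≈0 _ eq) (*-≈0 _ (≈⇒+≈0 zy≈1)) ⟩
    0# ∎) (no-cube-root-of-unity (x * z))

  square-≈0 : ∀ {x} → x ^ 2 ≈ 0# → x ≈ 0#
  square-≈0 {x} eq = proj₁ (norm-anisotropic x 0# (trans (solve 1 (λ x →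
    x :^ 2 :+ x :* con false :+ con false :^ 2 := x :^ 2) refl x) eq))

  square-injective : ∀ {x y} → x ^ 2 ≈ y ^ 2 → x ≈ y
  square-injective {x} {y} eq = +≈0⇒≈ (square-≈0 (trans
    (solve 2 (λ x y → (x :+ y) :^ 2 := x :^ 2 :+ y :^ 2) refl x y) (≈⇒+≈0 eq)))

  cube-injective : ∀ {x y} → x ^ 3 ≈ y ^ 3 → x ≈ y
  cube-injective {x} {y} eq with integral (x + y) (x ^ 2 + x * y + y ^ 2) (trans
    (solve 2 (λ x y → (x :+ y) :* (x :^ 2 :+ x :* y :+ y :^ 2) := x :^ 3 :+ y :^ 3) refl x y) (≈⇒+≈0 eq))
  ... | inj₁ x+y≈0 = +≈0⇒≈ x+y≈0
  ... | inj₂ norm≈0 = let x≈0 , y≈0 = norm-anisotropic x y norm≈0 in trans x≈0 (sym y≈0)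

  sixth-injective : ∀ {x y} → x ^ 6 ≈ y ^ 6 → x ≈ y
  sixth-injective {x} {y} eq = cube-injective (square-injective
    (trans (^-assocʳ x 3 2) (trans eq (sym (^-assocʳ y 3 2)))))

  fifth-injective : ∀ {x y} → x ^ 5 ≈ y ^ 5 → x ≈ y
  fifth-injective {x} {y} eq with integral (x + y) (norm (x * y) (x ^ 2 + y ^ 2)) (trans (fifth-factors x y) (≈⇒+≈0 eq))
  ... | inj₁ x+y≈0 = +≈0⇒≈ x+y≈0
  ... | inj₂ norm≈0 = square-injective (+≈0⇒≈ (proj₂ (norm-anisotropic (x * y) (x ^ 2 + y ^ 2) norm≈0)))

  dickson-cong : ∀ {x y} → x ≈ y → dickson x ≈ dickson y
  dickson-cong x≈y = +-cong (+-cong (^-congˡ 5 x≈y) (^-congˡ 3 x≈y)) x≈y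

  dickson-injective : ∀ {x y} → dickson x ≈ dickson y → x ≈ y
  dickson-injective {x} {y} eq with integral (x + y) (norm (x * y + 1#) (x ^ 2 + y ^ 2 + 1#)) (trans (dickson-factors x y) (≈⇒+≈0 eq))
  ... | inj₁ x+y≈0 = +≈0⇒≈ x+y≈0
  ... | inj₂ norm≈0 with xy+1≈0 , x²+y²+1≈0 ← norm-anisotropic (x * y + 1#) (x ^ 2 + y ^ 2 + 1#) norm≈0 =
    -- From x y = 1 and x² + y² = 1 follows x⁴ + x² + 1 = 0, and the left side is (x² + x + 1)².
    contradiction (square-≈0 (begin
      (x ^ 2 + x + 1#) ^ 2
        ≈⟨ solve 2 (λ x y → (x :^ 2 :+ x :+ con true) :^ 2 :=
             x :^ 2 :* (x :^ 2 :+ y :^ 2 :+ con true) :+ (x :* y :+ con true) :* (x :* y :+ con true)) refl x y ⟩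
      x ^ 2 * (x ^ 2 + y ^ 2 + 1#) + (x * y + 1#) * (x * y + 1#)
        ≈⟨ +-≈0 (*-≈0 (x ^ 2) x²+y²+1≈0) (*-≈0 (x * y + 1#) xy+1≈0) ⟩
      0# ∎)) (no-cube-root-of-unity x)

  dickson-surjective : ∀ y → ∃[ x ] dickson x ≈ y
  dickson-surjective = injective⇒surjective dickson dickson-cong dickson-injective

  -- The points (1, x⁵, x⁶) form an arc, equivalent to Segre's hyperoval
  -- {(1, t, t⁶)} under t = 1/x.  After division by the Vandermonde determinant
  -- their collinearity determinant is a norm from 𝔽₄.
  arc : ∀ x y z → (x ^ 6 + z ^ 6) * (y ^ 5 + z ^ 5) + (y ^ 6 + z ^ 6) * (x ^ 5 + z ^ 5) ≈ 0# →
        x ≈ y ⊎ y ≈ z ⊎ x ≈ z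
  arc x y z det≈0 = [ distinct , (λ norm≈0 →
      let e₂²≈0 , e₁e₃≈0 = norm-anisotropic (e₂ ^ 2) (x * y * z * (x + y + z)) norm≈0
      in degenerate (square-≈0 e₂²≈0) (integral (x * y * z) (x + y + z) e₁e₃≈0))
    ]′ (integral ((x + y) * (y + z) * (x + z)) (norm (e₂ ^ 2) (x * y * z * (x + y + z)))
         (trans (sym (collinear-factors x y z)) det≈0))
    where
    e₂ : Carrier
    e₂ = x * y + y * z + z * x

    distinct : (x + y) * (y + z) * (x + z) ≈ 0# → x ≈ y ⊎ y ≈ z ⊎ x ≈ z
    distinct eq with integral ((x + y) * (y + z)) (x + z) eq
    ... | inj₂ x+z≈0 = inj₂ (inj₂ (+≈0⇒≈ x+z≈0))
    ... | inj₁ eq′ with integral (x + y) (y + z) eq′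
    ...   | inj₁ x+y≈0 = inj₁ (+≈0⇒≈ x+y≈0)
    ...   | inj₂ y+z≈0 = inj₂ (inj₁ (+≈0⇒≈ y+z≈0))

    e₂-zero : ∀ u v w → u * v + v * w + w * u ≈ 0# → w ≈ 0# → u ≈ w ⊎ v ≈ w
    e₂-zero u v w e₂≈0 w≈0 = [ (λ u≈0 → inj₁ (trans u≈0 (sym w≈0))) , (λ v≈0 → inj₂ (trans v≈0 (sym w≈0))) ]′
      (integral u v (begin
        u * v                                     ≈⟨ solve 3 (λ u v w → u :* v :=
                                                       (u :* v :+ v :* w :+ w :* u) :+ (u :+ v) :* w) refl u v w ⟩
        (u * v + v * w + w * u) + (u + v) * w     ≈⟨ +-≈0 e₂≈0 (*-≈0 (u + v) w≈0) ⟩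
        0#                                        ∎))

    rotate : ∀ u v w → v * w + w * u + u * v ≈ u * v + v * w + w * u
    rotate = solve 3 (λ u v w → v :* w :+ w :* u :+ u :* v := u :* v :+ v :* w :+ w :* u) refl

    -- The norm can vanish only in these cases. If z = x + y, then e₂ becomes x² + x y + y², again
    -- an anisotropic norm. If one variable is 0, then e₂ is the product of the other two, so a
    -- second variable is 0 and equals the first.
    degenerate : e₂ ≈ 0# → x * y * z ≈ 0# ⊎ x + y + z ≈ 0# → x ≈ y ⊎ y ≈ z ⊎ x ≈ z
    degenerate e₂≈0 (inj₂ e₁≈0) =
      let x≈0 , y≈0 = norm-anisotropic x y (trans
            (solve 3 (λ x y z → :norm x y :=
               (x :* y :+ y :* z :+ z :* x) :+ (x :+ y) :* (x :+ y :+ z)) refl x y z)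
            (+-≈0 e₂≈0 (*-≈0 (x + y) e₁≈0)))
      in inj₁ (trans x≈0 (sym y≈0))
    degenerate e₂≈0 (inj₁ e₃≈0) with integral (x * y) z e₃≈0
    ... | inj₂ z≈0 = [ (λ x≈z → inj₂ (inj₂ x≈z)) , (λ y≈z → inj₂ (inj₁ y≈z)) ]′ (e₂-zero x y z e₂≈0 z≈0)
    ... | inj₁ xy≈0 with integral x y xy≈0
    ...   | inj₁ x≈0 = [ (λ y≈x → inj₁ (sym y≈x)) , (λ z≈x → inj₂ (inj₂ (sym z≈x))) ]′
                         (e₂-zero y z x (trans (rotate x y z) e₂≈0) x≈0)
    ...   | inj₂ y≈0 = [ (λ z≈y → inj₂ (inj₁ (sym z≈y))) , inj₁ ]′
                         (e₂-zero z x y (trans (sym (rotate z x y)) e₂≈0) y≈0)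

-- The map g, its fibres and the set Δ

module Kasami₂ {c ℓ} {R : CommutativeRing c ℓ} {m : ℕ} (isField : IsFiniteField R (suc (double m))) where
  open CommutativeRing R hiding (zero)
  open OddDegree isField public
  open import Algebra.Properties.Semiring.Exp semiring using (_^_; ^-congˡ)
  open import Relation.Binary.Reasoning.Setoid setoid

  -- Partial sums of s^(2ⁱ) and s^(4ⁱ). For n = 2m + 1, `∑2ⁱ n` is the absolute trace and
  -- `∑4ⁱ (suc m)` the half trace.
  ∑2ⁱ ∑4ⁱ : ℕ → Carrier → Carrier
  ∑2ⁱ zero    s = 0#
  ∑2ⁱ (suc k) s = ∑2ⁱ k s + frob k s
  ∑4ⁱ zero    s = 0#
  ∑4ⁱ (suc k) s = ∑4ⁱ k s + frob (double k) s

  ∑2ⁱ-artinSchreier : ∀ k s → ∑2ⁱ k s ^ 2 + ∑2ⁱ k s ≈ frob k s + s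
  ∑2ⁱ-artinSchreier zero s = solve 1 (λ s → con false :^ 2 :+ con false := s :^ 1 :+ s) refl s
  ∑2ⁱ-artinSchreier (suc k) s = begin
    (t + f) ^ 2 + (t + f)           ≈⟨ solve 2 (λ t f → (t :+ f) :^ 2 :+ (t :+ f) :=
                                         (t :^ 2 :+ t) :+ (f :^ 2 :+ f)) refl t f ⟩
    (t ^ 2 + t) + (f ^ 2 + f)       ≈⟨ +-congʳ (∑2ⁱ-artinSchreier k s) ⟩
    (f + s) + (f ^ 2 + f)           ≈⟨ solve 2 (λ f s → (f :+ s) :+ (f :^ 2 :+ f) := f :^ 2 :+ s) refl f s ⟩
    f ^ 2 + s                       ≈⟨ +-congʳ (frob-suc k s) ⟨
    frob (suc k) s + s              ∎
    where
    t f : Carrier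
    t = ∑2ⁱ k s
    f = frob k s

  -- Squaring shifts the even Frobenius exponents to the odd ones, so the two sums interleave.
  ∑4ⁱ-artinSchreier : ∀ k s → ∑4ⁱ k s ^ 2 + ∑4ⁱ k s ≈ ∑2ⁱ (double k) s
  ∑4ⁱ-artinSchreier zero s = solve 0 (con false :^ 2 :+ con false := con false) refl
  ∑4ⁱ-artinSchreier (suc k) s = begin
    (h + f) ^ 2 + (h + f)           ≈⟨ solve 2 (λ h f → (h :+ f) :^ 2 :+ (h :+ f) :=
                                         ((h :^ 2 :+ h) :+ f) :+ f :^ 2) refl h f ⟩
    ((h ^ 2 + h) + f) + f ^ 2       ≈⟨ +-cong (+-congʳ (∑4ⁱ-artinSchreier k s)) (sym (frob-suc (double k) s)) ⟩
    ∑2ⁱ (double (suc k)) s          ∎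
    where
    h f : Carrier
    h = ∑4ⁱ k s
    f = frob (double k) s

  -- For odd n the half trace of s solves u² + u = s + Tr s.
  artinSchreier-dichotomy : ∀ s → ∃[ u ] (u ^ 2 + u ≈ s ⊎ u ^ 2 + u ≈ s + 1#)
  artinSchreier-dichotomy s = u , [ (λ t≈0 → inj₁ (trans u²+u (trans (+-congʳ t≈0) (+-identityˡ s))))
                                  , (λ t≈1 → inj₂ (trans u²+u (trans (+-congʳ (+≈0⇒≈ t≈1)) (+-comm 1# s)))) ]′ t∈𝔽₂
    where
    u t : Carrier
    u = ∑4ⁱ (suc m) s
    t = ∑2ⁱ (suc (double m)) s
    u²+u : u ^ 2 + u ≈ t + s
    -- `double (suc m)` is n + 1, one term more than the trace; that last term is s^(2ⁿ) = s.
    u²+u = trans (∑4ⁱ-artinSchreier (suc m) s) (+-congˡ (fermat s))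
    t∈𝔽₂ : t ≈ 0# ⊎ t + 1# ≈ 0#
    t∈𝔽₂ = integral t (t + 1#) (begin
      t * (t + 1#)                     ≈⟨ solve 1 (λ t → t :* (t :+ con true) := t :^ 2 :+ t) refl t ⟩
      t ^ 2 + t                        ≈⟨ ∑2ⁱ-artinSchreier (suc (double m)) s ⟩
      frob (suc (double m)) s + s      ≈⟨ ≈⇒+≈0 (fermat s) ⟩
      0#                               ∎)

  g : Carrier → Carrier
  g r = r ^ 6 + r ^ 5

  g-cong : ∀ {r s} → r ≈ s → g r ≈ g s
  g-cong r≈s = +-cong (^-congˡ 6 r≈s) (^-congˡ 5 r≈s)

  δ : Carrier → Carrier
  δ b = b ^ 13 + (b + 1#) ^ 13 + 1#

  -- δ is invariant under b ↦ b + 1, hence a polynomial in b² + b + 1; its degree there is 6 because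
  -- the thirteenth powers leave degree 12 in b.
  δ≈g : ∀ b → δ b ≈ g (b ^ 2 + b + 1#)
  δ≈g = solve 1 (λ b → b :^ 13 :+ (b :+ con true) :^ 13 :+ con true :=
    (b :^ 2 :+ b :+ con true) :^ 6 :+ (b :^ 2 :+ b :+ con true) :^ 5) refl

  ≉+1 : ∀ {r} → ¬ r ≈ 1# → ¬ r + 1# ≈ 0#
  ≉+1 r≉1 = r≉1 ∘′ +≈0⇒≈

  -- A certificate with denominators cleared: `A`, `B` and `C` vanish when j = 1/(1 + z), k = 1/w
  -- and r + 1 = 1/`dickson z`. Since `dickson z` is z w², both r + r/(1 + z) + 1 and u² + u with u
  -- = (z + 1)/w are then equal to z² (z + 1)/w².
  trace-partner-identity : ∀ r z j k →
    let w = z ^ 2 + z + 1#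
        A = j * (1# + z) + 1#
        B = k * w + 1#
        C = dickson z * (r + 1#) + 1#
    in (1# + z) * w ^ 2 * z * ((r + r * j + 1#) + (((z + 1#) * k) ^ 2 + (z + 1#) * k)) ≈
       r * z * w ^ 2 * A + ((1# + z) ^ 3 * z * B + (z + 1#) ^ 2 * z * w) * B + z * C
  trace-partner-identity = solve 4 (λ r z j k →
    let w = z :^ 2 :+ z :+ con true
        A = j :* (con true :+ z) :+ con true
        B = k :* w :+ con true
        C = (z :^ 5 :+ z :^ 3 :+ z) :* (r :+ con true) :+ con true
    in (con true :+ z) :* w :^ 2 :* z :*
         ((r :+ r :* j :+ con true) :+ (((z :+ con true) :* k) :^ 2 :+ (z :+ con true) :* k)) :=
       r :* z :* w :^ 2 :* A :+ ((con true :+ z) :^ 3 :* z :* B :+ (z :+ con true) :^ 2 :* z :* w) :* B :+ z :* C) refl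

  -- With t = 1/r, the fibre of g over g r consists of the points where the line
  -- through (1, t, t⁶) and (0, 1, 1/g r) meets Segre's hyperoval; z = (t′ - t)/t
  -- at the second such point t′.
  g-partner : ∀ r → ∃[ r′ ] g r′ ≈ g r × ∃[ u ] u ^ 2 + u ≈ r + r′ + 1#
  g-partner r with r ≟ 0# | r ≟ 1#
  ... | yes r≈0 | _ = r + 1# , (begin
    g (r + 1#)     ≈⟨ g-cong (+-congʳ r≈0) ⟩
    g (0# + 1#)    ≈⟨ solve 0 ((con false :+ con true) :^ 6 :+ (con false :+ con true) :^ 5 :=
                               con false :^ 6 :+ con false :^ 5) refl ⟩
    g 0#           ≈⟨ g-cong r≈0 ⟨
    g r            ∎) , 0# , solve 1 (λ r → con false :^ 2 :+ con false := r :+ (r :+ con true) :+ con true) refl r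
  ... | no _ | yes r≈1 = r + 1# , (begin
    g (r + 1#)     ≈⟨ g-cong (+-congʳ r≈1) ⟩
    g (1# + 1#)    ≈⟨ solve 0 ((con true :+ con true) :^ 6 :+ (con true :+ con true) :^ 5 :=
                               con true :^ 6 :+ con true :^ 5) refl ⟩
    g 1#           ≈⟨ g-cong r≈1 ⟨
    g r            ∎) , 0# , solve 1 (λ r → con false :^ 2 :+ con false := r :+ (r :+ con true) :+ con true) refl r
  -- Division by r⁵ j⁶ turns g (r j) = g r into r + 1 + z = (r + 1)(1 + z)⁶. As (1 + z)⁶ = 1 + z
  -- `dickson z`, what remains after cancelling z is (r + 1) `dickson z` = 1.
  ... | no r≉0 | no r≉1 with i , i[r+1]≈1 ← invert (≉+1 r≉1) with z , Dz≈i ← dickson-surjective i =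
    r * j , g[rj]≈g[r] , (z + 1#) * k , sym (+≈0⇒≈ (*-cancelˡ-≈0 (*-≉0 (*-≉0 1+z≉0 w²≉0) z≉0) (begin
      (1# + z) * w ^ 2 * z * ((r + r * j + 1#) + (((z + 1#) * k) ^ 2 + (z + 1#) * k))
        ≈⟨ trace-partner-identity r z j k ⟩
      r * z * w ^ 2 * A + ((1# + z) ^ 3 * z * B + (z + 1#) ^ 2 * z * w) * B + z * C
        ≈⟨ +-≈0 (+-≈0 (*-≈0 _ A≈0) (*-≈0 _ B≈0)) (*-≈0 z C≈0) ⟩
      0# ∎)))
    where
    w : Carrier
    w = z ^ 2 + z + 1#
    w²≉0 : ¬ w ^ 2 ≈ 0#
    w²≉0 = no-cube-root-of-unity z ∘′ square-≈0
    C≈0 : dickson z * (r + 1#) + 1# ≈ 0#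
    C≈0 = ≈⇒+≈0 (trans (*-congʳ Dz≈i) i[r+1]≈1)
    z≉0 : ¬ z ≈ 0#
    z≉0 z≈0 = 1≉0 (begin
      1#                                                ≈⟨ solve 2 (λ z r → con true :=
        ((z :^ 5 :+ z :^ 3 :+ z) :* (r :+ con true) :+ con true) :+ ((z :^ 4 :+ z :^ 2 :+ con true) :* (r :+ con true)) :* z) refl z r ⟩
      (dickson z * (r + 1#) + 1#) + ((z ^ 4 + z ^ 2 + 1#) * (r + 1#)) * z ≈⟨ +-≈0 C≈0 (*-≈0 _ z≈0) ⟩
      0#                                                ∎)
    -- At z = 1 the Dickson polynomial takes the value 1, which would force r = 0.
    1+z≉0 : ¬ 1# + z ≈ 0#
    1+z≉0 1+z≈0 = r≉0 (begin
      r  ≈⟨ solve 2 (λ z r → r :=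
        ((z :^ 5 :+ z :^ 3 :+ z) :* (r :+ con true) :+ con true) :+ ((z :^ 4 :+ z :^ 3 :+ con true) :* (r :+ con true)) :* (con true :+ z)) refl z r ⟩
      (dickson z * (r + 1#) + 1#) + ((z ^ 4 + z ^ 3 + 1#) * (r + 1#)) * (1# + z)  ≈⟨ +-≈0 C≈0 (*-≈0 _ 1+z≈0) ⟩
      0# ∎)
    j k A B C : Carrier
    j = proj₁ (invert 1+z≉0)
    k = proj₁ (invert (no-cube-root-of-unity z))
    A = j * (1# + z) + 1#
    B = k * w + 1#
    C = dickson z * (r + 1#) + 1#
    A≈0 : A ≈ 0#
    A≈0 = ≈⇒+≈0 (proj₂ (invert 1+z≉0))
    B≈0 : B ≈ 0#
    B≈0 = ≈⇒+≈0 (proj₂ (invert (no-cube-root-of-unity z)))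
    g[rj]≈g[r] : g (r * j) ≈ g r
    g[rj]≈g[r] = begin
      g (r * j)
        ≈⟨ solve 3 (λ r z j → (r :* j) :^ 6 :+ (r :* j) :^ 5 :=
             r :^ 5 :* (r :+ con true) :* (j :* (con true :+ z)) :^ 6
             :+ (r :^ 5 :* j :^ 5 :* (j :* (con true :+ z) :+ con true)
             :+ r :^ 5 :* j :^ 6 :* z :* ((z :^ 5 :+ z :^ 3 :+ z) :* (r :+ con true) :+ con true))) refl r z j ⟩
      r ^ 5 * (r + 1#) * (j * (1# + z)) ^ 6 + (r ^ 5 * j ^ 5 * A + r ^ 5 * j ^ 6 * z * C)
        ≈⟨ +-cong (*-congˡ (^-congˡ 6 (proj₂ (invert 1+z≉0)))) (+-≈0 (*-≈0 _ A≈0) (*-≈0 _ C≈0)) ⟩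
      r ^ 5 * (r + 1#) * 1# ^ 6 + 0#
        ≈⟨ solve 1 (λ r → r :^ 5 :* (r :+ con true) :* con true :^ 6 :+ con false := r :^ 6 :+ r :^ 5) refl r ⟩
      g r ∎

  -- The points (1, r⁵, r⁶) with g r = c lie on one line, and a line meets the arc at most twice.
  g-fibre : ∀ x y z → g x ≈ g z → g y ≈ g z → x ≈ y ⊎ y ≈ z ⊎ x ≈ z
  g-fibre x y z gx≈gz gy≈gz = arc x y z (begin
    (x ^ 6 + z ^ 6) * (y ^ 5 + z ^ 5) + (y ^ 6 + z ^ 6) * (x ^ 5 + z ^ 5)
      ≈⟨ solve 3 (λ x y z →
           (x :^ 6 :+ z :^ 6) :* (y :^ 5 :+ z :^ 5) :+ (y :^ 6 :+ z :^ 6) :* (x :^ 5 :+ z :^ 5) :=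
           (y :^ 5 :+ z :^ 5) :* ((x :^ 6 :+ x :^ 5) :+ (z :^ 6 :+ z :^ 5)) :+
           (x :^ 5 :+ z :^ 5) :* ((y :^ 6 :+ y :^ 5) :+ (z :^ 6 :+ z :^ 5))) refl x y z ⟩
    (y ^ 5 + z ^ 5) * (g x + g z) + (x ^ 5 + z ^ 5) * (g y + g z)
      ≈⟨ +-≈0 (*-≈0 _ (≈⇒+≈0 gx≈gz)) (*-≈0 _ (≈⇒+≈0 gy≈gz)) ⟩
    0# ∎)

  Δ : Carrier → Set _
  Δ x = ∃[ b ] x ≈ δ b

  abstract
    Δ? : ∀ x → Dec (Δ x)
    Δ? x = any? (λ b≈b′ x≈δb → trans x≈δb (trans (δ≈g _) (trans (g-cong (+-congʳ (+-cong (^-congˡ 2 b≈b′) b≈b′))) (sym (δ≈g _)))))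
                (λ b → x ≟ δ b)

  Δ-resp : ∀ {x y} → x ≈ y → Δ x → Δ y
  Δ-resp x≈y (b , x≈δb) = b , trans (sym x≈y) x≈δb

  g∈Δ : ∀ r → Δ (g r)
  g∈Δ r with artinSchreier-dichotomy (r + 1#)
  ... | u , inj₁ u²+u≈r+1 = u , sym (trans (δ≈g u) (g-cong (begin
    u ^ 2 + u + 1#     ≈⟨ +-congʳ u²+u≈r+1 ⟩
    r + 1# + 1#        ≈⟨ solve 1 (λ r → r :+ con true :+ con true := r) refl r ⟩
    r                  ∎)))
  -- Here r itself has trace 0, so its partner r′ has trace 1; adding the two Artin-Schreier
  -- solutions produces the b with b² + b + 1 = r′.
  ... | u , inj₂ u²+u≈r+1+1 with r′ , gr′≈gr , v , v²+v≈ ← g-partner r =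
    u + v , sym (trans (δ≈g (u + v)) (trans (g-cong (begin
    (u + v) ^ 2 + (u + v) + 1#                ≈⟨ solve 2 (λ u v → (u :+ v) :^ 2 :+ (u :+ v) :+ con true :=
                                                   (u :^ 2 :+ u) :+ (v :^ 2 :+ v) :+ con true) refl u v ⟩
    (u ^ 2 + u) + (v ^ 2 + v) + 1#            ≈⟨ +-congʳ (+-cong u²+u≈r+1+1 v²+v≈) ⟩
    (r + 1# + 1#) + (r + r′ + 1#) + 1#        ≈⟨ solve 2 (λ r r′ →
                                                   (r :+ con true :+ con true) :+ (r :+ r′ :+ con true) :+ con true
                                                   := r′) refl r r′ ⟩
    r′                                        ∎)) gr′≈gr))

  g-two-to-one : ∀ x → count (λ r → g r ≟ x) ≡ 2 ℕ.* 𝟙 (Δ? x)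
  g-two-to-one x with Δ? x
  ... | no x∉Δ = ≡.trans (∑-cong (λ r → 𝟙-no (g r ≟ x) (λ gr≈x → x∉Δ (Δ-resp gr≈x (g∈Δ r)))))
                         (≡.trans (∑-const 0) (ℕₚ.*-zeroʳ (2 ℕ.^ suc (double m))))
  ... | yes (b , x≈δb) with r′ , gr′≈gr , u , u²+u≈ ← g-partner (b ^ 2 + b + 1#) =
    ≡.trans (∑-cong fibre) (≡.trans (∑-+ (λ s → 𝟙 (r ≟ s)) (λ s → 𝟙 (r′ ≟ s))) (cong₂ ℕ._+_ (count-≈ r) (count-≈ r′)))
    where
    r : Carrier
    r = b ^ 2 + b + 1#
    gr≈x : g r ≈ x
    gr≈x = sym (trans x≈δb (δ≈g b))
    gr′≈x : g r′ ≈ x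
    gr′≈x = trans gr′≈gr gr≈x
    r≉r′ : ¬ r ≈ r′
    r≉r′ r≈r′ = no-cube-root-of-unity u (≈⇒+≈0 (trans u²+u≈ (trans (+-congʳ (≈⇒+≈0 r≈r′)) (+-identityˡ 1#))))
    fibre : ∀ s → 𝟙 (g s ≟ x) ≡ 𝟙 (r ≟ s) ℕ.+ 𝟙 (r′ ≟ s)
    fibre s with r ≟ s | r′ ≟ s
    ... | yes r≈s | yes r′≈s = contradiction (trans r≈s (sym r′≈s)) r≉r′
    ... | yes r≈s | no  _    = 𝟙-yes (g s ≟ x) (trans (g-cong (sym r≈s)) gr≈x)
    ... | no  _   | yes r′≈s = 𝟙-yes (g s ≟ x) (trans (g-cong (sym r′≈s)) gr′≈x)
    ... | no r≉s  | no r′≉s  = 𝟙-no (g s ≟ x) λ gs≈x →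
      [ r≉r′ , [ r′≉s , r≉s ]′ ]′ (g-fibre r r′ s (trans gr≈x (sym gs≈x)) (trans gr′≈x (sym gs≈x)))

-- Counting the triples

cubic-cancel : ∀ q a → 1 ℕ.< q → q ℕ.* (q ℕ.* q) ℕ.+ a ≡ q ℕ.* a ℕ.+ q ℕ.* q → a ≡ q ℕ.* q
cubic-cancel 1 a (ℕ.s≤s ()) _
-- The hypothesis is q³ = q² + (q - 1)a written without subtraction. With p = q - 1, which is
-- nonzero, both sides contain q² + a, and p q² = p a is left.
cubic-cancel q@(suc p@(suc _)) a _ eq =
  ≡.sym (ℕₚ.*-cancelˡ-≡ (q ℕ.* q) a p (ℕₚ.+-cancelʳ-≡ (q ℕ.* q ℕ.+ a) _ _ (begin
    p ℕ.* (q ℕ.* q) ℕ.+ (q ℕ.* q ℕ.+ a)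
      ≡⟨ N.solve 2 (λ p a → p N.:* (1+ p N.:* 1+ p) N.:+ (1+ p N.:* 1+ p N.:+ a) N.:=
                            1+ p N.:* (1+ p N.:* 1+ p) N.:+ a) ≡.refl p a ⟩
    q ℕ.* (q ℕ.* q) ℕ.+ a
      ≡⟨ eq ⟩
    q ℕ.* a ℕ.+ q ℕ.* q
      ≡⟨ N.solve 2 (λ p a → 1+ p N.:* a N.:+ 1+ p N.:* 1+ p N.:=
                            p N.:* a N.:+ (1+ p N.:* 1+ p N.:+ a)) ≡.refl p a ⟩
    p ℕ.* a ℕ.+ (q ℕ.* q ℕ.+ a) ∎)))
  where
  open ≡-Reasoning
  infix 10 1+_
  1+_ : ∀ {k} → N.Polynomial k → N.Polynomial k
  1+ x = N.con 1 N.:+ x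

eighth : ∀ m k → 8 ℕ.* k ≡ 2 ℕ.^ suc (double m) ℕ.* 2 ℕ.^ suc (double m) →
         k ≡ 2 ℕ.^ (2 ℕ.* suc (double m) ℕ.∸ 3)
-- For n = 1 the equation reads 8k = 4, which is absurd; 𝔽₂ has no two distinct nonzero elements. So
-- the truncated exponent 2 ∸ 3 is never reached.
eighth zero    zero    ()
eighth zero    (suc k) eq = contradiction (≡.trans (≡.sym (ℕₚ.*-suc 8 k)) eq) λ ()
eighth (suc m) k       eq = ℕₚ.*-cancelˡ-≡ k _ 8 (≡.trans eq (begin
  2 ℕ.^ d ℕ.* 2 ℕ.^ d               ≡⟨ ℕₚ.^-distribˡ-+-* 2 d d ⟨
  -- Now d ≥ 3, so 2d and 3 + (2d ∸ 3) agree by computation.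
  2 ℕ.^ (d ℕ.+ d)                   ≡⟨ cong (2 ℕ.^_) (cong (d ℕ.+_) (≡.sym (ℕₚ.+-identityʳ d))) ⟩
  2 ℕ.^ (3 ℕ.+ (2 ℕ.* d ℕ.∸ 3))     ≡⟨ ℕₚ.^-distribˡ-+-* 2 3 (2 ℕ.* d ℕ.∸ 3) ⟩
  8 ℕ.* 2 ℕ.^ (2 ℕ.* d ℕ.∸ 3)       ∎))
  where
  open ≡-Reasoning
  d : ℕ
  d = suc (double (suc m))

module TripleCount {c ℓ} {R : CommutativeRing c ℓ} {m : ℕ} (isField : IsFiniteField R (suc (double m))) where
  open CommutativeRing R hiding (zero)
  open Kasami₂ isField public
  open import Algebra.Properties.Semiring.Exp semiring using (_^_; ^-congˡ)

  q : ℕ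
  q = 2 ℕ.^ suc (double m)

  Space : Setoid c ℓ
  Space = ×-setoid setoid (×-setoid setoid setoid)

  space-cardinality : Space HasCardinality (q ℕ.* (q ℕ.* q))
  space-cardinality = ×-hasCardinality cardinality (×-hasCardinality cardinality cardinality)

  module Sp = Enumerated space-cardinality
  module ≈S = Setoid Space

  space-scaling : ∀ {x} → ¬ x ≈ 0# → Inverse Space Space
  space-scaling x≉0 = scaling x≉0 ×-inverse (scaling x≉0 ×-inverse scaling x≉0)

  ∑Δ : (Carrier → ℕ) → ℕ
  ∑Δ f = ∑ (λ x → 𝟙 (Δ? x) ℕ.* f x)

  ∑Δ-cong : {f f′ : Carrier → ℕ} → (∀ x → f x ≡ f′ x) → ∑Δ f ≡ ∑Δ f′
  ∑Δ-cong eq = ∑-cong (λ x → cong (𝟙 (Δ? x) ℕ.*_) (eq x))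

  ∑Δ-* : ∀ k f → ∑Δ (λ x → k ℕ.* f x) ≡ k ℕ.* ∑Δ f
  ∑Δ-* k f = ≡.trans (∑-cong (λ x → x∙yz≈y∙xz (𝟙 (Δ? x)) k (f x))) (*-∑ k (λ x → 𝟙 (Δ? x) ℕ.* f x))
    where open import Algebra.Properties.CommutativeSemigroup ℕₚ.*-commutativeSemigroup using (x∙yz≈y∙xz)

  -- Passing from Δ to the parameter r costs a factor 2 per coordinate; three coordinates give the
  -- factor 8.
  ∑-∘g : ∀ f → f Preserves _≈_ ⟶ _≡_ → ∑ (f ∘ g) ≡ 2 ℕ.* ∑Δ f
  ∑-∘g f f-cong = begin
    ∑ (f ∘ g)                                   ≡⟨ ∑-fibres cardinality cardinality g f f-cong ⟩
    ∑ (λ x → count (λ r → g r ≟ x) ℕ.* f x)     ≡⟨ ∑-cong (λ x → cong (ℕ._* f x) (g-two-to-one x)) ⟩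
    ∑ (λ x → 2 ℕ.* 𝟙 (Δ? x) ℕ.* f x)            ≡⟨ ∑-cong (λ x → ℕₚ.*-assoc 2 (𝟙 (Δ? x)) (f x)) ⟩
    ∑ (λ x → 2 ℕ.* (𝟙 (Δ? x) ℕ.* f x))          ≡⟨ *-∑ 2 (λ x → 𝟙 (Δ? x) ℕ.* f x) ⟩
    2 ℕ.* ∑Δ f                                  ∎
    where open ≡-Reasoning

  module _ (v₁ v₂ : Carrier) (v₁≉0 : ¬ v₁ ≈ 0#) (v₂≉0 : ¬ v₂ ≈ 0#) (v₃≉0 : ¬ v₁ + v₂ ≈ 0#) where

    linear : ≈S.Carrier → Carrier
    linear (x , y , z) = v₁ * x + v₂ * y + (v₁ + v₂) * z

    linear-cong : ∀ {p p′} → p ≈S.≈ p′ → linear p ≈ linear p′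
    linear-cong (x≈ , y≈ , z≈) = +-cong (+-cong (*-congˡ x≈) (*-congˡ y≈)) (*-congˡ z≈)

    diagonal : ℕ → ≈S.Carrier → Carrier
    diagonal k (x , y , z) = linear (x ^ k , y ^ k , z ^ k)

    diagonal-cong : ∀ k {p p′} → p ≈S.≈ p′ → diagonal k p ≈ diagonal k p′
    diagonal-cong k (x≈ , y≈ , z≈) = linear-cong (^-congˡ k x≈ , ^-congˡ k y≈ , ^-congˡ k z≈)

    diagonal-respects : ∀ k → (λ p → diagonal k p ≈ 0#) Respects ≈S._≈_
    diagonal-respects k p≈p′ eq = trans (diagonal-cong k (≈S.sym p≈p′)) eq

    -- The coefficients v₁, v₂, v₁ + v₂ sum to 0, so a common zero is a linear dependency among
    -- three points (1, r⁵, r⁶) and `arc` makes two coordinates equal. The degree 5 form then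
    -- reduces to a nonzero coefficient times a difference of two fifth powers.
    common-zero : ∀ x y z → diagonal 6 (x , y , z) ≈ 0# → diagonal 5 (x , y , z) ≈ 0# → x ≈ y × x ≈ z
    common-zero x y z S₆≈0 S₅≈0 = [ x≈y⇒ , [ y≈z⇒ , x≈z⇒ ]′ ]′ (arc x y z (*-cancelˡ-≈0 v₁≉0 (begin
      v₁ * ((x ^ 6 + z ^ 6) * (y ^ 5 + z ^ 5) + (y ^ 6 + z ^ 6) * (x ^ 5 + z ^ 5))
        ≈⟨ solve 8 (λ v₁ v₂ x⁵ y⁵ z⁵ x⁶ y⁶ z⁶ →
             v₁ :* ((x⁶ :+ z⁶) :* (y⁵ :+ z⁵) :+ (y⁶ :+ z⁶) :* (x⁵ :+ z⁵)) :=
             (y⁵ :+ z⁵) :* (v₁ :* x⁶ :+ v₂ :* y⁶ :+ (v₁ :+ v₂) :* z⁶) :+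
             (y⁶ :+ z⁶) :* (v₁ :* x⁵ :+ v₂ :* y⁵ :+ (v₁ :+ v₂) :* z⁵)) refl
             v₁ v₂ (x ^ 5) (y ^ 5) (z ^ 5) (x ^ 6) (y ^ 6) (z ^ 6) ⟩
      (y ^ 5 + z ^ 5) * diagonal 6 (x , y , z) + (y ^ 6 + z ^ 6) * diagonal 5 (x , y , z)
        ≈⟨ +-≈0 (*-≈0 (y ^ 5 + z ^ 5) S₆≈0) (*-≈0 (y ^ 6 + z ^ 6) S₅≈0) ⟩
      0# ∎)))
      where
      open import Relation.Binary.Reasoning.Setoid setoid

      fifths : ∀ {v a b} → ¬ v ≈ 0# → v * (a ^ 5 + b ^ 5) ≈ 0# → a ≈ b
      fifths v≉0 eq = fifth-injective (+≈0⇒≈ (*-cancelˡ-≈0 v≉0 eq))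

      x≈y⇒ : x ≈ y → x ≈ y × x ≈ z
      x≈y⇒ x≈y = x≈y , fifths v₃≉0 (begin
        (v₁ + v₂) * (x ^ 5 + z ^ 5)
          ≈⟨ solve 5 (λ v₁ v₂ x y z → (v₁ :+ v₂) :* (x :+ z) :=
               (v₁ :* x :+ v₂ :* y :+ (v₁ :+ v₂) :* z) :+ v₂ :* (x :+ y)) refl v₁ v₂ (x ^ 5) (y ^ 5) (z ^ 5) ⟩
        diagonal 5 (x , y , z) + v₂ * (x ^ 5 + y ^ 5)
          ≈⟨ +-≈0 S₅≈0 (*-≈0 v₂ (≈⇒+≈0 (^-congˡ 5 x≈y))) ⟩
        0# ∎)

      y≈z⇒ : y ≈ z → x ≈ y × x ≈ z
      y≈z⇒ y≈z = trans x≈z (sym y≈z) , x≈z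
        where
        x≈z : x ≈ z
        x≈z = fifths v₁≉0 (begin
          v₁ * (x ^ 5 + z ^ 5)
            ≈⟨ solve 5 (λ v₁ v₂ x y z → v₁ :* (x :+ z) :=
                 (v₁ :* x :+ v₂ :* y :+ (v₁ :+ v₂) :* z) :+ v₂ :* (y :+ z)) refl v₁ v₂ (x ^ 5) (y ^ 5) (z ^ 5) ⟩
          diagonal 5 (x , y , z) + v₂ * (y ^ 5 + z ^ 5)
            ≈⟨ +-≈0 S₅≈0 (*-≈0 v₂ (≈⇒+≈0 (^-congˡ 5 y≈z))) ⟩
          0# ∎)

      x≈z⇒ : x ≈ z → x ≈ y × x ≈ z
      x≈z⇒ x≈z = trans x≈z (sym y≈z) , x≈z
        where
        y≈z : y ≈ z
        y≈z = fifths v₂≉0 (begin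
          v₂ * (y ^ 5 + z ^ 5)
            ≈⟨ solve 5 (λ v₁ v₂ x y z → v₂ :* (y :+ z) :=
                 (v₁ :* x :+ v₂ :* y :+ (v₁ :+ v₂) :* z) :+ v₁ :* (x :+ z)) refl v₁ v₂ (x ^ 5) (y ^ 5) (z ^ 5) ⟩
          diagonal 5 (x , y , z) + v₁ * (x ^ 5 + z ^ 5)
            ≈⟨ +-≈0 S₅≈0 (*-≈0 v₁ (≈⇒+≈0 (^-congˡ 5 x≈z))) ⟩
          0# ∎)

    diagonal-constant : ∀ k x → diagonal k (x , x , x) ≈ 0#
    diagonal-constant k x = solve 3 (λ v₁ v₂ x → v₁ :* x :+ v₂ :* x :+ (v₁ :+ v₂) :* x := con false) refl v₁ v₂ (x ^ k)

    Common : ≈S.Carrier → Set _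
    Common p = diagonal 6 p ≈ 0# × diagonal 5 p ≈ 0#

    Common? : ∀ p → Dec (Common p)
    Common? p = (diagonal 6 p ≟ 0#) ×-dec (diagonal 5 p ≟ 0#)

    count-common : Sp.count Common? ≡ q
    count-common = Sp.count-card
      (λ p≈p′ (eq₆ , eq₅) → diagonal-respects 6 p≈p′ eq₆ , diagonal-respects 5 p≈p′ eq₅) Common? (cardinality ⟫ record
      { to        = λ x → (x , x , x) , diagonal-constant 6 x , diagonal-constant 5 x
      ; from      = λ ((x , _) , _) → x
      ; to-cong   = λ eq → eq , eq , eq
      ; from-cong = proj₁
      ; inverse   = (λ { {(x , y , z) , eq₆ , eq₅} eq →
                         let x≈y , x≈z = common-zero x y z eq₆ eq₅
                         in eq , trans eq x≈y , trans eq x≈z })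
                  , proj₁
      })

    -- Because k-th powers permute the field, the first two coordinates of a zero are free and
    -- determine the third.
    count-diagonal : ∀ k → (∀ {x y} → x ^ k ≈ y ^ k → x ≈ y) →
                     Sp.count (λ p → diagonal k p ≟ 0#) ≡ q ℕ.* q
    count-diagonal k ^k-injective = Sp.count-card (diagonal-respects k) (λ p → diagonal k p ≟ 0#)
      (×-hasCardinality cardinality cardinality ⟫ record
      { to        = λ (x , y) → (x , y , third x y) , third-zero x y
      ; from      = λ ((x , y , _) , _) → x , y
      ; to-cong   = λ (x≈ , y≈) → x≈ , y≈ , unique x≈ y≈ (third-zero _ _) (third-zero _ _)
      ; from-cong = λ (x≈ , y≈ , _) → x≈ , y≈
      ; inverse   = (λ { {(x , y , z) , eq₀} (x≈ , y≈) → x≈ , y≈ , unique x≈ y≈ (third-zero _ _) eq₀ })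
                  , (λ (x≈ , y≈ , _) → x≈ , y≈)
      })
      where
      open import Relation.Binary.Reasoning.Setoid setoid
      v₃⁻¹ : Carrier
      v₃⁻¹ = proj₁ (invert v₃≉0)
      root : ∀ y → ∃[ x ] x ^ k ≈ y
      root = injective⇒surjective (_^ k) (^-congˡ k) ^k-injective
      third : Carrier → Carrier → Carrier
      third x y = proj₁ (root (v₃⁻¹ * (v₁ * x ^ k + v₂ * y ^ k)))
      third-zero : ∀ x y → diagonal k (x , y , third x y) ≈ 0#
      third-zero x y = begin
        s + (v₁ + v₂) * third x y ^ k      ≈⟨ +-congˡ (*-congˡ (proj₂ (root (v₃⁻¹ * s)))) ⟩
        s + (v₁ + v₂) * (v₃⁻¹ * s)         ≈⟨ solve 3 (λ s v v⁻¹ → s :+ v :* (v⁻¹ :* s) :=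
                                                s :* (v⁻¹ :* v :+ con true)) refl s (v₁ + v₂) v₃⁻¹ ⟩
        s * (v₃⁻¹ * (v₁ + v₂) + 1#)        ≈⟨ *-≈0 s (≈⇒+≈0 (proj₂ (invert v₃≉0))) ⟩
        0#                                 ∎
        where
        s : Carrier
        s = v₁ * x ^ k + v₂ * y ^ k
      unique : ∀ {x x′ y y′ z z′} → x ≈ x′ → y ≈ y′ →
               diagonal k (x , y , z) ≈ 0# → diagonal k (x′ , y′ , z′) ≈ 0# → z ≈ z′
      unique x≈ y≈ eq eq′ = ^k-injective (*-cancelˡ-≈ v₃≉0 (+-cancelˡ _ _ _ (trans eq (trans (sym eq′)
        (+-congʳ (+-cong (*-congˡ (^-congˡ k (sym x≈))) (*-congˡ (^-congˡ k (sym y≈)))))))))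
        where open import Algebra.Properties.Group +-group using () renaming (∙-cancelˡ to +-cancelˡ)

    pencil? : ∀ t p → Dec (t * diagonal 6 p + diagonal 5 p ≈ 0#)
    pencil? t p = t * diagonal 6 p + diagonal 5 p ≟ 0#

    g³ : ≈S.Carrier → ≈S.Carrier
    g³ (x , y , z) = g x , g y , g z

    A : ℕ
    A = Sp.count (λ p → linear (g³ p) ≟ 0#)

    -- One formula for the three cases of one, no or q solutions t; the indicator of a = 0 is added
    -- on the left to avoid a subtraction on the right.
    count-affine : ∀ a b → ∑ (λ t → 𝟙 (t * a + b ≟ 0#)) ℕ.+ 𝟙 (a ≟ 0#) ≡
                           1 ℕ.+ q ℕ.* 𝟙 ((a ≟ 0#) ×-dec (b ≟ 0#))
    count-affine a b with a ≟ 0# | b ≟ 0#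
    ... | yes a≈0 | yes b≈0 = ≡.trans (cong (ℕ._+ 1) (≡.trans
            (∑-cong (λ t → 𝟙-yes (t * a + b ≟ 0#) (+-≈0 (*-≈0 t a≈0) b≈0))) (∑-const 1))) (ℕₚ.+-comm (q ℕ.* 1) 1)
    ... | yes a≈0 | no  b≉0 = ≡.trans (cong (ℕ._+ 1) (≡.trans
            (∑-cong (λ t → 𝟙-no (t * a + b ≟ 0#) λ eq →
              b≉0 (trans (sym (trans (+-congʳ (*-≈0 t a≈0)) (+-identityˡ b))) eq))) (∑-const 0))) (ℕₚ.+-comm (q ℕ.* 0) 1)
    ... | no a≉0 | _ = ≡.trans (≡.trans (ℕₚ.+-identityʳ _) (≡.trans
            (∑-cong (λ t → 𝟙-cong (t * a + b ≟ 0#) (a⁻¹ * b ≟ t) (solution t) (solves t))) (count-≈ (a⁻¹ * b))))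
            (cong suc (≡.sym (ℕₚ.*-zeroʳ q)))
      where
      open import Relation.Binary.Reasoning.Setoid setoid
      a⁻¹ : Carrier
      a⁻¹ = proj₁ (invert a≉0)
      a⁻¹a+1≈0 : a⁻¹ * a + 1# ≈ 0#
      a⁻¹a+1≈0 = ≈⇒+≈0 (proj₂ (invert a≉0))
      solution : ∀ t → t * a + b ≈ 0# → a⁻¹ * b ≈ t
      solution t eq = +≈0⇒≈ (begin
        a⁻¹ * b + t                             ≈⟨ solve 4 (λ a a⁻¹ b t → a⁻¹ :* b :+ t :=
          a⁻¹ :* (t :* a :+ b) :+ t :* (a⁻¹ :* a :+ con true)) refl a a⁻¹ b t ⟩
        a⁻¹ * (t * a + b) + t * (a⁻¹ * a + 1#)  ≈⟨ +-≈0 (*-≈0 a⁻¹ eq) (*-≈0 t a⁻¹a+1≈0) ⟩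
        0#                                      ∎)
      solves : ∀ t → a⁻¹ * b ≈ t → t * a + b ≈ 0#
      solves t eq = begin
        t * a + b                               ≈⟨ solve 4 (λ a a⁻¹ b t → t :* a :+ b :=
          a :* (a⁻¹ :* b :+ t) :+ b :* (a⁻¹ :* a :+ con true)) refl a a⁻¹ b t ⟩
        a * (a⁻¹ * b + t) + b * (a⁻¹ * a + 1#)  ≈⟨ +-≈0 (*-≈0 a (≈⇒+≈0 eq)) (*-≈0 b a⁻¹a+1≈0) ⟩
        0#                                      ∎

    -- Summing `count-affine` over all triples adds q² on the left, from the zeros of the degree 6
    -- form, and q · q on the right, from the q common zeros; these cancel.
    count-pencil : Sp.∑ (λ p → ∑ (λ t → 𝟙 (pencil? t p))) ≡ q ℕ.* (q ℕ.* q)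
    count-pencil = ℕₚ.+-cancelʳ-≡ (q ℕ.* q) _ _ (begin
      Sp.∑ f ℕ.+ q ℕ.* q                                      ≡⟨ cong (Sp.∑ f ℕ.+_) (count-diagonal 6 sixth-injective) ⟨
      Sp.∑ f ℕ.+ Sp.count (λ p → diagonal 6 p ≟ 0#)           ≡⟨ Sp.∑-+ f (λ p → 𝟙 (diagonal 6 p ≟ 0#)) ⟨
      Sp.∑ (λ p → f p ℕ.+ 𝟙 (diagonal 6 p ≟ 0#))              ≡⟨ Sp.∑-cong (λ p → count-affine (diagonal 6 p) (diagonal 5 p)) ⟩
      Sp.∑ (λ p → 1 ℕ.+ q ℕ.* 𝟙 (Common? p))                  ≡⟨ Sp.∑-+ (λ _ → 1) (λ p → q ℕ.* 𝟙 (Common? p)) ⟩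
      Sp.∑ (λ _ → 1) ℕ.+ Sp.∑ (λ p → q ℕ.* 𝟙 (Common? p))     ≡⟨ cong₂ ℕ._+_ (≡.trans (Sp.∑-const 1) (ℕₚ.*-identityʳ _))
                                                                             (≡.trans (Sp.*-∑ q (𝟙 ∘ Common?)) (cong (q ℕ.*_) count-common)) ⟩
      q ℕ.* (q ℕ.* q) ℕ.+ q ℕ.* q                             ∎)
      where
      open ≡-Reasoning
      f : ≈S.Carrier → ℕ
      f p = ∑ (λ t → 𝟙 (pencil? t p))

    -- g (t r) = t⁵ (t r⁶ + r⁵): the bijective scaling by t ≠ 0 carries the zeros of the pencil
    -- member at t to those of `linear` after `g³`.
    linear∘g³ : ∀ x y z t → linear (g³ (t * x , t * y , t * z)) ≈
                            t ^ 5 * (t * diagonal 6 (x , y , z) + diagonal 5 (x , y , z))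
    linear∘g³ = solve 6 (λ v₁ v₂ x y z t →
      let :g = λ r → r :^ 6 :+ r :^ 5
          :linear = λ x y z → v₁ :* x :+ v₂ :* y :+ (v₁ :+ v₂) :* z
      in :linear (:g (t :* x)) (:g (t :* y)) (:g (t :* z)) :=
         t :^ 5 :* (t :* :linear (x :^ 6) (y :^ 6) (z :^ 6) :+ :linear (x :^ 5) (y :^ 5) (z :^ 5))) refl v₁ v₂

    g³-cong : ∀ {p p′} → p ≈S.≈ p′ → g³ p ≈S.≈ g³ p′
    g³-cong (x≈ , y≈ , z≈) = g-cong x≈ , g-cong y≈ , g-cong z≈

    count-member : ∀ t → ¬ t ≈ 0# → Sp.count (pencil? t) ≡ A
    count-member t t≉0 = ≡.sym (≡.trans
      (Sp.sum-reindex ℕₚ.+-0-commutativeMonoid (space-scaling t≉0)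
        λ {p} {p′} p≈p′ → let eq = linear-cong (g³-cong p≈p′) in
          𝟙-cong (linear (g³ p) ≟ 0#) (linear (g³ p′) ≟ 0#) (trans (sym eq)) (trans eq))
      (Sp.∑-cong λ p@(x , y , z) →
        𝟙-cong (linear (g³ (t * x , t * y , t * z)) ≟ 0#) (pencil? t p)
          (λ eq → *-cancelˡ-≈0 t⁵≉0 (trans (sym (linear∘g³ x y z t)) eq))
          (λ eq → trans (linear∘g³ x y z t) (*-≈0 (t ^ 5) eq))))
      where
      t⁵≉0 : ¬ t ^ 5 ≈ 0#
      t⁵≉0 eq = t≉0 (fifth-injective (trans eq (solve 0 (con false := con false :^ 5) refl)))

    count-member-0 : ∀ t → t ≈ 0# → Sp.count (pencil? t) ≡ q ℕ.* q
    count-member-0 t t≈0 = ≡.trans (Sp.∑-cong λ p →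
        let eq = trans (+-congʳ (trans (*-comm t (diagonal 6 p)) (*-≈0 (diagonal 6 p) t≈0))) (+-identityˡ (diagonal 5 p)) in
        𝟙-cong (pencil? t p) (diagonal 5 p ≟ 0#) (trans (sym eq)) (trans eq))
      (count-diagonal 5 fifth-injective)

    A≡q² : A ≡ q ℕ.* q
    A≡q² = cubic-cancel q A 1<q (begin
      q ℕ.* (q ℕ.* q) ℕ.+ A
        ≡⟨ cong₂ ℕ._+_ (≡.trans (≡.sym count-pencil) (∑-swap space-cardinality cardinality (λ p t → 𝟙 (pencil? t p))))
                       (≡.sym (∑-𝟙-≈ (λ _ → A) (λ _ → ≡.refl) 0#)) ⟩
      ∑ (λ t → Sp.count (pencil? t)) ℕ.+ ∑ (λ t → 𝟙 (0# ≟ t) ℕ.* A)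
        ≡⟨ ∑-+ (λ t → Sp.count (pencil? t)) (λ t → 𝟙 (0# ≟ t) ℕ.* A) ⟨
      ∑ (λ t → Sp.count (pencil? t) ℕ.+ 𝟙 (0# ≟ t) ℕ.* A)
        ≡⟨ ∑-cong pointwise ⟩
      ∑ (λ t → A ℕ.+ 𝟙 (0# ≟ t) ℕ.* (q ℕ.* q))
        ≡⟨ ∑-+ (λ _ → A) (λ t → 𝟙 (0# ≟ t) ℕ.* (q ℕ.* q)) ⟩
      ∑ (λ _ → A) ℕ.+ ∑ (λ t → 𝟙 (0# ≟ t) ℕ.* (q ℕ.* q))
        ≡⟨ cong₂ ℕ._+_ (∑-const A) (∑-𝟙-≈ (λ _ → q ℕ.* q) (λ _ → ≡.refl) 0#) ⟩
      q ℕ.* A ℕ.+ q ℕ.* q ∎)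
      where
      open ≡-Reasoning
      1<q : 1 ℕ.< q
      1<q = ℕₚ.^-monoʳ-< 2 (ℕ.s≤s (ℕ.s≤s ℕ.z≤n)) {0} {suc (double m)} (ℕ.s≤s ℕ.z≤n)
      -- The member at t = 0 is exceptional, with q² zeros instead of `A`. Adding `A` there on one
      -- side and q² on the other makes the equation uniform in t.
      pointwise : ∀ t → Sp.count (pencil? t) ℕ.+ 𝟙 (0# ≟ t) ℕ.* A ≡ A ℕ.+ 𝟙 (0# ≟ t) ℕ.* (q ℕ.* q)
      pointwise t with 0# ≟ t
      ... | yes 0≈t = ≡.trans (cong₂ ℕ._+_ (count-member-0 t (sym 0≈t)) (ℕₚ.*-identityˡ A))
                              (≡.trans (ℕₚ.+-comm (q ℕ.* q) A) (cong (A ℕ.+_) (≡.sym (ℕₚ.*-identityˡ (q ℕ.* q)))))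
      ... | no  0≉t = cong (ℕ._+ 0) (count-member t (0≉t ∘′ sym))

    ΔTriple : ≈S.Carrier → Set _
    ΔTriple (x , y , z) = (Δ x × Δ y × Δ z) × linear (x , y , z) ≈ 0#

    ΔTriple? : ∀ p → Dec (ΔTriple p)
    ΔTriple? (x , y , z) = (Δ? x ×-dec Δ? y ×-dec Δ? z) ×-dec (linear (x , y , z) ≟ 0#)

    ΔTriple-respects : ΔTriple Respects ≈S._≈_
    ΔTriple-respects p≈p′@(x≈ , y≈ , z≈) ((Δx , Δy , Δz) , eq) =
      (Δ-resp x≈ Δx , Δ-resp y≈ Δy , Δ-resp z≈ Δz) , trans (sym (linear-cong p≈p′)) eq

    A≡8·count : A ≡ 8 ℕ.* Sp.count ΔTriple?
    A≡8·count = begin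
      A
        ≡⟨ ∑-×³ (λ p → 𝟙 (linear (g³ p) ≟ 0#)) ⟩
      ∑ (λ x → ∑ (λ y → ∑ (λ z → h (g x) (g y) (g z))))
        ≡⟨ ∑-cong (λ x → ∑-cong (λ y → ∑-∘g (h (g x) (g y)) (λ {z} {z′} → h-cong (g x) (g x) (g y) (g y) z z′ refl refl))) ⟩
      ∑ (λ x → ∑ (λ y → 2 ℕ.* h₁ (g x) (g y)))
        ≡⟨ ∑-cong (λ x → ∑-∘g (λ y → 2 ℕ.* h₁ (g x) y)
             (λ {y} {y′} y≈y′ → cong (2 ℕ.*_) (h₁-cong (g x) (g x) y y′ refl y≈y′))) ⟩
      ∑ (λ x → 2 ℕ.* ∑Δ (λ y → 2 ℕ.* h₁ (g x) y))
        ≡⟨ ∑-∘g (λ x → 2 ℕ.* ∑Δ (λ y → 2 ℕ.* h₁ x y))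
             (λ {x} {x′} x≈x′ → cong (2 ℕ.*_) (∑Δ-cong λ y → cong (2 ℕ.*_) (h₁-cong x x′ y y x≈x′ refl))) ⟩
      2 ℕ.* ∑Δ (λ x → 2 ℕ.* ∑Δ (λ y → 2 ℕ.* h₁ x y))
        ≡⟨ cong (2 ℕ.*_) (∑Δ-* 2 (λ x → ∑Δ (λ y → 2 ℕ.* h₁ x y))) ⟩
      2 ℕ.* (2 ℕ.* ∑Δ (λ x → ∑Δ (λ y → 2 ℕ.* h₁ x y)))
        ≡⟨ cong (λ k → 2 ℕ.* (2 ℕ.* k)) (≡.trans (∑Δ-cong (λ x → ∑Δ-* 2 (h₁ x))) (∑Δ-* 2 (∑Δ ∘ h₁))) ⟩
      2 ℕ.* (2 ℕ.* (2 ℕ.* ∑Δ (∑Δ ∘ h₁)))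
        ≡⟨ N.solve 1 (λ k → N.con 2 N.:* (N.con 2 N.:* (N.con 2 N.:* k)) N.:= N.con 8 N.:* k) ≡.refl (∑Δ (∑Δ ∘ h₁)) ⟩
      8 ℕ.* ∑Δ (∑Δ ∘ h₁)
        ≡⟨ cong (8 ℕ.*_) (∑-cong inner) ⟩
      8 ℕ.* ∑ (λ x → ∑ (λ y → ∑ (λ z → 𝟙 (ΔTriple? (x , y , z)))))
        ≡⟨ cong (8 ℕ.*_) (∑-×³ (𝟙 ∘ ΔTriple?)) ⟨
      8 ℕ.* Sp.count ΔTriple? ∎
      where
      open ≡-Reasoning
      ∑-×³ : ∀ f → Sp.∑ f ≡ ∑ (λ x → ∑ (λ y → ∑ (λ z → f (x , y , z))))
      ∑-×³ f = ≡.trans (∑-× cardinality (×-hasCardinality cardinality cardinality) f)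
                       (∑-cong λ x → ∑-× cardinality cardinality (λ yz → f (x , yz)))
      h : Carrier → Carrier → Carrier → ℕ
      h x y z = 𝟙 (linear (x , y , z) ≟ 0#)
      h-cong : ∀ x x′ y y′ z z′ → x ≈ x′ → y ≈ y′ → z ≈ z′ → h x y z ≡ h x′ y′ z′
      h-cong x x′ y y′ z z′ x≈ y≈ z≈ = let eq = linear-cong (x≈ , y≈ , z≈) in
        𝟙-cong (linear (x , y , z) ≟ 0#) (linear (x′ , y′ , z′) ≟ 0#) (trans (sym eq)) (trans eq)
      h₁ : Carrier → Carrier → ℕ
      h₁ x y = ∑Δ (h x y)
      h₁-cong : ∀ x x′ y y′ → x ≈ x′ → y ≈ y′ → h₁ x y ≡ h₁ x′ y′
      h₁-cong x x′ y y′ x≈ y≈ = ∑Δ-cong (λ z → h-cong x x′ y y′ z z x≈ y≈ refl)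
      inner : ∀ x → 𝟙 (Δ? x) ℕ.* ∑Δ (λ y → ∑Δ (h x y)) ≡ ∑ (λ y → ∑ (λ z → 𝟙 (ΔTriple? (x , y , z))))
      inner x = ≡.trans (≡.sym (*-∑ (𝟙 (Δ? x)) (λ y → 𝟙 (Δ? y) ℕ.* ∑Δ (h x y)))) (∑-cong λ y →
        ≡.trans (≡.sym (ℕₚ.*-assoc (𝟙 (Δ? x)) (𝟙 (Δ? y)) (∑Δ (h x y))))
        (≡.trans (≡.sym (*-∑ (𝟙 (Δ? x) ℕ.* 𝟙 (Δ? y)) (λ z → 𝟙 (Δ? z) ℕ.* h x y z))) (∑-cong λ z →
        (begin
          𝟙 (Δ? x) ℕ.* 𝟙 (Δ? y) ℕ.* (𝟙 (Δ? z) ℕ.* h x y z)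
            ≡⟨ N.solve 4 (λ a b c d → a N.:* b N.:* (c N.:* d) N.:= a N.:* (b N.:* c) N.:* d) ≡.refl
                 (𝟙 (Δ? x)) (𝟙 (Δ? y)) (𝟙 (Δ? z)) (h x y z) ⟩
          𝟙 (Δ? x) ℕ.* (𝟙 (Δ? y) ℕ.* 𝟙 (Δ? z)) ℕ.* h x y z
            ≡⟨ cong (λ k → 𝟙 (Δ? x) ℕ.* k ℕ.* h x y z) (𝟙-× (Δ? y) (Δ? z)) ⟨
          𝟙 (Δ? x) ℕ.* 𝟙 (Δ? y ×-dec Δ? z) ℕ.* h x y z
            ≡⟨ cong (ℕ._* h x y z) (𝟙-× (Δ? x) (Δ? y ×-dec Δ? z)) ⟨
          𝟙 (Δ? x ×-dec Δ? y ×-dec Δ? z) ℕ.* h x y z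
            ≡⟨ 𝟙-× (Δ? x ×-dec Δ? y ×-dec Δ? z) (linear (x , y , z) ≟ 0#) ⟨
          𝟙 (ΔTriple? (x , y , z)) ∎))))

    triples-cardinality : Subset Space ΔTriple HasCardinality (2 ℕ.^ (2 ℕ.* suc (double m) ℕ.∸ 3))
    triples-cardinality = ≡.subst (Subset Space ΔTriple HasCardinality_)
      (eighth m (Sp.count ΔTriple?) (≡.trans (≡.sym A≡8·count) A≡q²))
      (Sp.subset-hasCardinality ΔTriple-respects ΔTriple?)

-- Roots of the polynomial of degree 15

module QuinticRoots {c ℓ} {R : CommutativeRing c ℓ} {m : ℕ} (isField : IsFiniteField R (suc (double m))) where
  open CommutativeRing R hiding (zero)
  open TripleCount isField public
  open import Algebra.Properties.Semiring.Exp semiring using (_^_; ^-congˡ)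
  open import Relation.Binary.Reasoning.Setoid setoid

  quintic : Carrier → Carrier → Carrier → Carrier
  quintic a b t = (a * t ^ 5 + b) ^ 3 + (t ^ 3 + 1#) ^ 5

  module _ {a b : Carrier} (a≉0 : ¬ a ≈ 0#) (b≉0 : ¬ b ≈ 0#) (a⁶+b⁶≈1 : a ^ 6 + b ^ 6 ≈ 1#) where

    a³+b³+1≈0 : a ^ 3 + b ^ 3 + 1# ≈ 0#
    a³+b³+1≈0 = square-≈0 (begin
      (a ^ 3 + b ^ 3 + 1#) ^ 2       ≈⟨ solve 2 (λ a b → (a :^ 3 :+ b :^ 3 :+ con true) :^ 2 :=
                                          (a :^ 6 :+ b :^ 6) :+ con true) refl a b ⟩
      (a ^ 6 + b ^ 6) + 1#           ≈⟨ ≈⇒+≈0 a⁶+b⁶≈1 ⟩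
      0#                             ∎)

    -- At t = a/b the inner terms are a t⁵ + b = (a⁶ + b⁶)/b⁵ = b⁻⁵ and t³ + 1 = (a³ + b³)/b³ = b⁻³,
    -- so both summands equal b⁻¹⁵.
    quintic-root : ∀ b⁻¹ → b⁻¹ * b ≈ 1# → quintic a b (a * b⁻¹) ≈ 0#
    quintic-root d db≈1 = ≈⇒+≈0 (begin
      (a * (a * d) ^ 5 + b) ^ 3          ≈⟨ ^-congˡ 3 at⁵+b≈d⁵ ⟩
      (d ^ 5) ^ 3                        ≈⟨ solve 1 (λ d → (d :^ 5) :^ 3 := (d :^ 3) :^ 5) refl d ⟩
      (d ^ 3) ^ 5                        ≈⟨ ^-congˡ 5 t³+1≈d³ ⟨
      ((a * d) ^ 3 + 1#) ^ 5             ∎)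
      where
      at⁵+b≈d⁵ : a * (a * d) ^ 5 + b ≈ d ^ 5
      at⁵+b≈d⁵ = begin
        a * (a * d) ^ 5 + b                        ≈⟨ +-congˡ (trans (*-congʳ (^-congˡ 5 db≈1))
                                                        (solve 1 (λ b → con true :^ 5 :* b := b) refl b)) ⟨
        a * (a * d) ^ 5 + (d * b) ^ 5 * b          ≈⟨ solve 3 (λ a b d →
          a :* (a :* d) :^ 5 :+ (d :* b) :^ 5 :* b := d :^ 5 :* (a :^ 6 :+ b :^ 6)) refl a b d ⟩
        d ^ 5 * (a ^ 6 + b ^ 6)                    ≈⟨ *-congˡ a⁶+b⁶≈1 ⟩
        d ^ 5 * 1#                                 ≈⟨ *-identityʳ (d ^ 5) ⟩
        d ^ 5                                      ∎
      t³+1≈d³ : (a * d) ^ 3 + 1# ≈ d ^ 3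
      t³+1≈d³ = begin
        (a * d) ^ 3 + 1#                           ≈⟨ +-congˡ (trans (^-congˡ 3 db≈1)
                                                        (solve 0 (con true :^ 3 := con true) refl)) ⟨
        (a * d) ^ 3 + (d * b) ^ 3                  ≈⟨ solve 3 (λ a b d →
          (a :* d) :^ 3 :+ (d :* b) :^ 3 := d :^ 3 :* (a :^ 3 :+ b :^ 3 :+ con true) :+ d :^ 3) refl a b d ⟩
        d ^ 3 * (a ^ 3 + b ^ 3 + 1#) + d ^ 3       ≈⟨ +-congʳ (*-≈0 (d ^ 3) a³+b³+1≈0) ⟩
        0# + d ^ 3                                 ≈⟨ +-identityˡ (d ^ 3) ⟩
        d ^ 3                                      ∎

    -- Writing t³ + 1 = w³, a root t makes (t/a, 1/b, w) a common zero of the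
    -- diagonal forms of degrees 5 and 6 with coefficients a⁶, b⁶, 1.
    quintic-root-unique : ∀ b⁻¹ → b⁻¹ * b ≈ 1# → ∀ t → quintic a b t ≈ 0# → t ≈ a * b⁻¹
    quintic-root-unique d db≈1 t root = begin
      t                ≈⟨ *-identityˡ t ⟨
      1# * t           ≈⟨ *-congʳ ea≈1 ⟨
      e * a * t        ≈⟨ solve 3 (λ e a t → e :* a :* t := a :* (t :* e)) refl e a t ⟩
      a * (t * e)      ≈⟨ *-congˡ te≈d ⟩
      a * d            ∎
      where
      e w : Carrier
      e = proj₁ (invert a≉0)
      ea≈1 : e * a ≈ 1#
      ea≈1 = proj₂ (invert a≉0)
      cube-root : ∃[ w ] w ^ 3 ≈ t ^ 3 + 1#
      cube-root = injective⇒surjective (_^ 3) (^-congˡ 3) cube-injective (t ^ 3 + 1#)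
      w = proj₁ cube-root
      w³≈t³+1 : w ^ 3 ≈ t ^ 3 + 1#
      w³≈t³+1 = proj₂ cube-root
      -- The root equation only equates the cubes of the two sides; injectivity of cubing removes
      -- the outer exponent.
      w⁵≈at⁵+b : w ^ 5 ≈ a * t ^ 5 + b
      w⁵≈at⁵+b = cube-injective (begin
        (w ^ 5) ^ 3             ≈⟨ solve 1 (λ w → (w :^ 5) :^ 3 := (w :^ 3) :^ 5) refl w ⟩
        (w ^ 3) ^ 5             ≈⟨ ^-congˡ 5 w³≈t³+1 ⟩
        (t ^ 3 + 1#) ^ 5        ≈⟨ +≈0⇒≈ root ⟨
        (a * t ^ 5 + b) ^ 3     ∎)
      te≈d : t * e ≈ d
      -- The sixth powers cancel the denominators: a⁶ (t/a)⁶ = t⁶ and a⁶ (t/a)⁵ = a t⁵, and likewise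
      -- b⁶ (1/b)⁵ = b.
      te≈d = proj₁ (common-zero (a ^ 6) (b ^ 6) (a≉0 ∘′ sixth-≈0) (b≉0 ∘′ sixth-≈0)
                      (λ eq → 1≉0 (trans (sym a⁶+b⁶≈1) eq)) (t * e) d w S₆≈0 S₅≈0)
        where
        sixth-≈0 : ∀ {x} → x ^ 6 ≈ 0# → x ≈ 0#
        sixth-≈0 eq = sixth-injective (trans eq (solve 0 (con false := con false :^ 6) refl))
        S₆≈0 : a ^ 6 * (t * e) ^ 6 + b ^ 6 * d ^ 6 + (a ^ 6 + b ^ 6) * w ^ 6 ≈ 0#
        S₆≈0 = begin
          a ^ 6 * (t * e) ^ 6 + b ^ 6 * d ^ 6 + (a ^ 6 + b ^ 6) * w ^ 6
            ≈⟨ solve 7 (λ a b d e t w s → a :^ 6 :* (t :* e) :^ 6 :+ b :^ 6 :* d :^ 6 :+ s :* w :^ 6 :=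
                 t :^ 6 :* (e :* a) :^ 6 :+ (d :* b) :^ 6 :+ s :* (w :^ 3) :^ 2) refl a b d e t w (a ^ 6 + b ^ 6) ⟩
          t ^ 6 * (e * a) ^ 6 + (d * b) ^ 6 + (a ^ 6 + b ^ 6) * (w ^ 3) ^ 2
            ≈⟨ +-cong (+-cong (*-congˡ (^-congˡ 6 ea≈1)) (^-congˡ 6 db≈1)) (*-cong a⁶+b⁶≈1 (^-congˡ 2 w³≈t³+1)) ⟩
          t ^ 6 * 1# ^ 6 + 1# ^ 6 + 1# * (t ^ 3 + 1#) ^ 2
            ≈⟨ solve 1 (λ t → t :^ 6 :* con true :^ 6 :+ con true :^ 6 :+ con true :* (t :^ 3 :+ con true) :^ 2
                 := con false) refl t ⟩
          0# ∎
        S₅≈0 : a ^ 6 * (t * e) ^ 5 + b ^ 6 * d ^ 5 + (a ^ 6 + b ^ 6) * w ^ 5 ≈ 0#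
        S₅≈0 = begin
          a ^ 6 * (t * e) ^ 5 + b ^ 6 * d ^ 5 + (a ^ 6 + b ^ 6) * w ^ 5
            ≈⟨ solve 7 (λ a b d e t w⁵ s → a :^ 6 :* (t :* e) :^ 5 :+ b :^ 6 :* d :^ 5 :+ s :* w⁵ :=
                 a :* t :^ 5 :* (e :* a) :^ 5 :+ b :* (d :* b) :^ 5 :+ s :* w⁵) refl a b d e t (w ^ 5) (a ^ 6 + b ^ 6) ⟩
          a * t ^ 5 * (e * a) ^ 5 + b * (d * b) ^ 5 + (a ^ 6 + b ^ 6) * w ^ 5
            ≈⟨ +-cong (+-cong (*-congˡ (^-congˡ 5 ea≈1)) (*-congˡ (^-congˡ 5 db≈1))) (*-cong a⁶+b⁶≈1 w⁵≈at⁵+b) ⟩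
          a * t ^ 5 * 1# ^ 5 + b * 1# ^ 5 + 1# * (a * t ^ 5 + b)
            ≈⟨ solve 3 (λ a b t → a :* t :^ 5 :* con true :^ 5 :+ b :* con true :^ 5 :+ con true :* (a :* t :^ 5 :+ b)
                 := con false) refl a b t ⟩
          0# ∎

-- Evaluation and degree of coefficient lists

module Polynomials {c ℓ₁ ℓ₂} (K : HeytingField c ℓ₁ ℓ₂) where
  open HeytingField K hiding (zero)
  open FieldNotions K
  open Polynomial
  open CommutativeRing (HeytingCommutativeRing.commutativeRing heytingCommutativeRing) using (commutativeSemiring; semiring)
  open import Algebra.Properties.Semiring.Exp semiring using (^-congˡ)
  open import Algebra.Solver.Ring.NaturalCoefficients.Default commutativeSemiring
  open import Relation.Binary.Reasoning.Setoid setoid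

  eval-+ : ∀ f g t → eval (f +ₚ g) t ≈ eval f t + eval g t
  eval-+ []      g       t = sym (+-identityˡ (eval g t))
  eval-+ (r ∷ f) []      t = sym (+-identityʳ (eval (r ∷ f) t))
  eval-+ (r ∷ f) (s ∷ g) t = begin
    (r + s) + t * eval (f +ₚ g) t           ≈⟨ +-congˡ (*-congˡ (eval-+ f g t)) ⟩
    (r + s) + t * (eval f t + eval g t)     ≈⟨ solve 5 (λ r s t x y → (r :+ s) :+ t :* (x :+ y) :=
                                                 (r :+ t :* x) :+ (s :+ t :* y)) refl r s t (eval f t) (eval g t) ⟩
    eval (r ∷ f) t + eval (s ∷ g) t         ∎

  eval-scale : ∀ r g t → eval (map (r *_) g) t ≈ r * eval g t
  eval-scale r []      t = sym (zeroʳ r)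
  eval-scale r (s ∷ g) t = trans (+-congˡ (*-congˡ (eval-scale r g t)))
    (solve 4 (λ r s t y → r :* s :+ t :* (r :* y) := r :* (s :+ t :* y)) refl r s t (eval g t))

  eval-* : ∀ f g t → eval (f *ₚ g) t ≈ eval f t * eval g t
  eval-* []      g t = sym (zeroˡ (eval g t))
  eval-* (r ∷ f) g t = begin
    eval (map (r *_) g +ₚ (0# ∷ (f *ₚ g))) t            ≈⟨ eval-+ (map (r *_) g) (0# ∷ (f *ₚ g)) t ⟩
    eval (map (r *_) g) t + (0# + t * eval (f *ₚ g) t)  ≈⟨ +-cong (eval-scale r g t) (+-congˡ (*-congˡ (eval-* f g t))) ⟩
    r * eval g t + (0# + t * (eval f t * eval g t))     ≈⟨ solve 4 (λ r t x y → r :* y :+ (con 0 :+ t :* (x :* y)) :=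
                                                             (r :+ t :* x) :* y) refl r t (eval f t) (eval g t) ⟩
    eval (r ∷ f) t * eval g t                           ∎

  eval-const : ∀ r t → eval (const r) t ≈ r
  eval-const r t = trans (+-congˡ (zeroʳ t)) (+-identityʳ r)

  eval-X : ∀ t → eval X t ≈ t
  eval-X = solve 1 (λ t → con 0 :+ t :* (con 1 :+ t :* con 0) := t) refl

  eval-^ : ∀ f k t → eval (f ^ₚ k) t ≈ eval f t ^ k
  eval-^ f zero    t = eval-const 1# t
  eval-^ f (suc k) t = trans (eval-* f (f ^ₚ k) t) (*-congˡ (eval-^ f k t))

  coeff-+ : ∀ f g i → coeff (f +ₚ g) i ≈ coeff f i + coeff g i
  coeff-+ []      g       i       = sym (+-identityˡ (coeff g i))
  coeff-+ (r ∷ f) []      i       = sym (+-identityʳ (coeff (r ∷ f) i))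
  coeff-+ (r ∷ f) (s ∷ g) zero    = refl
  coeff-+ (r ∷ f) (s ∷ g) (suc i) = coeff-+ f g i

  coeff-scale : ∀ r g i → coeff (map (r *_) g) i ≈ r * coeff g i
  coeff-scale r []      i       = sym (zeroʳ r)
  coeff-scale r (s ∷ g) zero    = refl
  coeff-scale r (s ∷ g) (suc i) = coeff-scale r g i

  coeff-*-0 : ∀ r f g → coeff ((r ∷ f) *ₚ g) 0 ≈ r * coeff g 0
  coeff-*-0 r f g = trans (coeff-+ (map (r *_) g) (0# ∷ (f *ₚ g)) 0)
    (trans (+-identityʳ (coeff (map (r *_) g) 0)) (coeff-scale r g 0))

  coeff-*-suc : ∀ r f g i → coeff ((r ∷ f) *ₚ g) (suc i) ≈ r * coeff g (suc i) + coeff (f *ₚ g) i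
  coeff-*-suc r f g i = trans (coeff-+ (map (r *_) g) (0# ∷ (f *ₚ g)) (suc i)) (+-congʳ (coeff-scale r g (suc i)))

  -- r may vanish, so d is only an upper bound for the degree.
  record Leads (f : Poly) (d : ℕ) (r : Carrier) : Set ℓ₁ where
    constructor leading
    field
      top   : coeff f d ≈ r
      above : ∀ i → d ℕ.< i → coeff f i ≈ 0#

  Leads-const : ∀ r → Leads (const r) 0 r
  Leads-const r = leading refl λ { (suc i) _ → refl }

  Leads-X : Leads X 1 1#
  Leads-X = leading refl λ { (suc (suc i)) _ → refl ; (suc zero) (ℕ.s≤s ()) }

  Leads-resp : ∀ {f d r s} → r ≈ s → Leads f d r → Leads f d s
  Leads-resp r≈s (leading top above) = leading (trans top r≈s) above

  Leads-+ : ∀ {f g d r s} → Leads f d r → Leads g d s → Leads (f +ₚ g) d (r + s)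
  Leads-+ {f} {g} {d} (leading top above) (leading top′ above′) =
    leading (trans (coeff-+ f g d) (+-cong top top′))
    λ i d<i → trans (coeff-+ f g i) (trans (+-cong (above i d<i) (above′ i d<i)) (+-identityʳ 0#))

  Leads-raise : ∀ {f d e r} → d ℕ.< e → Leads f d r → Leads f e 0#
  Leads-raise d<e (leading _ above) = leading (above _ d<e) λ i e<i → above i (ℕₚ.<-trans d<e e<i)

  coeff-zero-* : ∀ f g → (∀ i → coeff f i ≈ 0#) → ∀ i → coeff (f *ₚ g) i ≈ 0#
  coeff-zero-* []      g f≈0 i       = refl
  coeff-zero-* (r ∷ f) g f≈0 zero    = trans (coeff-*-0 r f g) (trans (*-congʳ (f≈0 0)) (zeroˡ (coeff g 0)))
  coeff-zero-* (r ∷ f) g f≈0 (suc i) = begin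
    coeff ((r ∷ f) *ₚ g) (suc i)             ≈⟨ coeff-*-suc r f g i ⟩
    r * coeff g (suc i) + coeff (f *ₚ g) i   ≈⟨ +-cong (*-congʳ (f≈0 0)) (coeff-zero-* f g (f≈0 ∘ suc) i) ⟩
    0# * coeff g (suc i) + 0#                ≈⟨ solve 1 (λ x → con 0 :* x :+ con 0 := con 0) refl (coeff g (suc i)) ⟩
    0#                                       ∎

  -- For d = 0 the tail of the first factor may still be a nonempty list of zeros, which
  -- `coeff-zero-*` disposes of. For d > 0 the head contributes only up to degree e, so the
  -- coefficients above come from the shifted product of the tail.
  Leads-* : ∀ f g {d e r s} → Leads f d r → Leads g e s → Leads (f *ₚ g) (d ℕ.+ e) (r * s)
  Leads-* [] g {s = s} (leading top _) _ = leading (trans (sym (zeroˡ s)) (*-congʳ top)) λ _ _ → refl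
  Leads-* (r₀ ∷ f) g {zero} {e} {r} {s} (leading top above) (leading top′ above′) = leading (begin
    coeff ((r₀ ∷ f) *ₚ g) e  ≈⟨ scaled e ⟩
    r₀ * coeff g e           ≈⟨ *-cong top top′ ⟩
    r * s                    ∎) λ i e<i → trans (scaled i) (trans (*-congˡ (above′ i e<i)) (zeroʳ r₀))
    where
    scaled : ∀ i → coeff ((r₀ ∷ f) *ₚ g) i ≈ r₀ * coeff g i
    scaled zero    = coeff-*-0 r₀ f g
    scaled (suc i) = trans (coeff-*-suc r₀ f g i)
      (trans (+-congˡ (coeff-zero-* f g (λ j → above (suc j) (ℕ.s≤s ℕ.z≤n)) i)) (+-identityʳ (r₀ * coeff g (suc i))))
  Leads-* (r₀ ∷ f) g {suc d} {e} {r} {s} (leading top above) (leading top′ above′) =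
    leading (trans (shifted (d ℕ.+ e) (ℕₚ.m≤n+m e d)) (Leads.top rest))
    λ { (suc i) (ℕ.s≤s d+e<i) → trans (shifted i (ℕₚ.≤-trans (ℕₚ.m≤n+m e d) (ℕₚ.<⇒≤ d+e<i))) (Leads.above rest i d+e<i) }
    where
    rest : Leads (f *ₚ g) (d ℕ.+ e) (r * s)
    rest = Leads-* f g (leading top λ i d<i → above (suc i) (ℕ.s≤s d<i)) (leading top′ above′)
    shifted : ∀ i → e ℕ.≤ i → coeff ((r₀ ∷ f) *ₚ g) (suc i) ≈ coeff (f *ₚ g) i
    shifted i e≤i = begin
      coeff ((r₀ ∷ f) *ₚ g) (suc i)              ≈⟨ coeff-*-suc r₀ f g i ⟩
      r₀ * coeff g (suc i) + coeff (f *ₚ g) i    ≈⟨ +-congʳ (trans (*-congˡ (above′ (suc i) (ℕ.s≤s e≤i))) (zeroʳ r₀)) ⟩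
      0# + coeff (f *ₚ g) i                      ≈⟨ +-identityˡ (coeff (f *ₚ g) i) ⟩
      coeff (f *ₚ g) i                           ∎

  Leads-^ : ∀ f k {d r} → Leads f d r → Leads (f ^ₚ k) (k ℕ.* d) (r ^ k)
  Leads-^ f zero    _     = Leads-const 1#
  Leads-^ f (suc k) leads = Leads-* f (f ^ₚ k) leads (Leads-^ f k leads)

  quinticₚ : Carrier → Carrier → Poly
  quinticₚ a b = (const a *ₚ X ^ₚ 5 +ₚ const b) ^ₚ 3 +ₚ (X ^ₚ 3 +ₚ const 1#) ^ₚ 5

  eval-quinticₚ : ∀ a b t → eval (quinticₚ a b) t ≈ (a * t ^ 5 + b) ^ 3 + (t ^ 3 + 1#) ^ 5
  eval-quinticₚ a b t = begin
    eval (quinticₚ a b) t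
      ≈⟨ eval-+ (f₁ ^ₚ 3) (f₂ ^ₚ 5) t ⟩
    eval (f₁ ^ₚ 3) t + eval (f₂ ^ₚ 5) t
      ≈⟨ +-cong (eval-^ f₁ 3 t) (eval-^ f₂ 5 t) ⟩
    eval f₁ t ^ 3 + eval f₂ t ^ 5
      ≈⟨ +-cong (^-congˡ 3 f₁-eval) (^-congˡ 5 f₂-eval) ⟩
    (a * t ^ 5 + b) ^ 3 + (t ^ 3 + 1#) ^ 5 ∎
    where
    f₁ f₂ : Poly
    f₁ = const a *ₚ X ^ₚ 5 +ₚ const b
    f₂ = X ^ₚ 3 +ₚ const 1#
    eval-Xᵏ : ∀ k → eval (X ^ₚ k) t ≈ t ^ k
    eval-Xᵏ k = trans (eval-^ X k t) (^-congˡ k (eval-X t))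
    f₁-eval : eval f₁ t ≈ a * t ^ 5 + b
    f₁-eval = trans (eval-+ (const a *ₚ X ^ₚ 5) (const b) t)
      (+-cong (trans (eval-* (const a) (X ^ₚ 5) t) (*-cong (eval-const a t) (eval-Xᵏ 5))) (eval-const b t))
    f₂-eval : eval f₂ t ≈ t ^ 3 + 1#
    f₂-eval = trans (eval-+ (X ^ₚ 3) (const 1#) t) (+-cong (eval-Xᵏ 3) (eval-const 1# t))

  -- Both powers reach degree 15, as 3 · 5 and 5 · 3, with top coefficients a³ and 1.
  quinticₚ-leads : ∀ a b → Leads (quinticₚ a b) 15 (a ^ 3 + 1#)
  quinticₚ-leads a b = Leads-+
    (Leads-^ f₁ 3 (Leads-resp (solve 1 (λ a → a :* con 1 :^ 5 :+ con 0 := a) refl a)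
      (Leads-+ (Leads-* (const a) (X ^ₚ 5) (Leads-const a) (Leads-^ X 5 Leads-X))
               (Leads-raise (ℕ.s≤s ℕ.z≤n) (Leads-const b)))))
    (Leads-resp (solve 0 ((con 1 :^ 3 :+ con 0) :^ 5 := con 1) refl) (Leads-^ f₂ 5
      (Leads-+ (Leads-^ X 3 Leads-X)
               (Leads-raise (ℕ.s≤s ℕ.z≤n) (Leads-const 1#)))))
    where
    f₁ f₂ : Poly
    f₁ = const a *ₚ X ^ₚ 5 +ₚ const b
    f₂ = X ^ₚ 3 +ₚ const 1#

-- Parity, apartness and the conclusion

odd-double : ∀ n → gcd 2 n ≡ 1 → ∃[ m ] n ≡ suc (double m)
odd-double n gcd≡1 with parity n
  where
  parity : ∀ n → ∃[ m ] (n ≡ double m ⊎ n ≡ suc (double m))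
  parity zero    = zero , inj₁ ≡.refl
  parity (suc n) with parity n
  ... | m , inj₁ n≡ = m , inj₂ (cong suc n≡)
  ... | m , inj₂ n≡ = suc m , inj₁ (cong suc n≡)
... | m , inj₂ n≡ = m , n≡
... | m , inj₁ ≡.refl = contradiction (∣1⇒≡1 (≡.subst (2 ∣_) gcd≡1 (gcd-greatest ∣-refl (2∣double m)))) λ ()
  where
  2∣double : ∀ m → 2 ∣ double m
  2∣double zero    = divides 0 ≡.refl
  2∣double (suc m) with divides k eq ← 2∣double m = divides (suc k) (cong (2 ℕ.+_) eq)

module Apartness {c ℓ₁ ℓ₂} (K : HeytingField c ℓ₁ ℓ₂) {n : ℕ} (card : HeytingField.setoid K HasCardinality n) where
  open HeytingField K hiding (zero)

  #⇒≉ : ∀ {x y} → x # y → ¬ x ≈ y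
  #⇒≉ {x} {y} x#y x≈y = proj₂ (tight x y) x≈y x#y

  x-0≈x : ∀ x → x - 0# ≈ x
  x-0≈x x = trans (+-congˡ -0#≈0#) (+-identityʳ x)
    where
    open CommutativeRing (HeytingCommutativeRing.commutativeRing heytingCommutativeRing) using (ring)
    open import Algebra.Properties.Ring ring using (-0#≈0#)

  inverse⇒#0 : ∀ {x y} → y * x ≈ 1# → x # 0#
  inverse⇒#0 {x} {y} yx≈1 = invertible⇒# (y , trans (*-congˡ (x-0≈x x)) yx≈1
                                             , trans (*-congʳ (x-0≈x x)) (trans (*-comm x y) yx≈1))

  #0⇒inverse : ∀ {x} → x # 0# → ∃[ y ] y * x ≈ 1#
  #0⇒inverse {x} x#0 = let y , eq , _ = #⇒invertible x#0 in y , trans (*-congˡ (sym (x-0≈x x))) eq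

  -- Tightness only turns a refutation of x # 0 into an equality. Searching the finite carrier for
  -- an inverse removes the resulting double negation.
  ≉0⇒inverse : ∀ {x} → ¬ x ≈ 0# → ∃[ y ] y * x ≈ 1#
  ≉0⇒inverse {x} x≉0 with any? (λ y≈y′ eq → trans (*-congʳ (sym y≈y′)) eq) (λ y → y * x ≟ 1#)
    where open Enumerated card
  ... | yes inverse = inverse
  ... | no ¬inverse = contradiction (proj₁ (tight x 0#) (¬inverse ∘′ #0⇒inverse)) x≉0

  1≉0 : ¬ 1# ≈ 0#
  1≉0 = #⇒≉ (inverse⇒#0 (*-identityʳ 1#))

  isFiniteField : ∀ {k} → n ≡ 2 ℕ.^ k → IsFiniteField (HeytingCommutativeRing.commutativeRing heytingCommutativeRing) k
  isFiniteField ≡.refl = record { 1≉0 = 1≉0 ; invert = ≉0⇒inverse ; cardinality = card }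

theorem11p11 :
    ∀ {c ℓ₁ ℓ₂} (n : ℕ) → 0 ℕ.< n → gcd 2 n ≡ 1 →
    (K : HeytingField c ℓ₁ ℓ₂) →
    let open HeytingField K
        open FieldNotions K
        open Kasami 2
        open Polynomial
    in
    setoid HasCardinality (2 ℕ.^ n) →
    (∀ v₁ v₂ → v₁ # 0# → v₂ # 0# → v₁ # v₂ →
       ΔTriples v₁ v₂ HasCardinality (2 ℕ.^ (2 ℕ.* n ℕ.∸ 3)))
    ×
    (∀ a b → a # 0# → a # 1# → (b#0 : b # 0#) → b # 1# →
       a ^ 6 + b ^ 6 ≈ 1# →
       let f = (const a *ₚ X ^ₚ 5 +ₚ const b) ^ₚ 3 +ₚ (X ^ₚ 3 +ₚ const 1#) ^ₚ 5
       in HasDegree f 15 × IsUniqueRoot f (a / b [ b#0 ]))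
theorem11p11 n _ gcd≡1 K card with m , ≡.refl ← odd-double n gcd≡1 = triples , unique-root
  where
  open HeytingField K hiding (zero)
  open FieldNotions K
  open Kasami 2
  open Polynomial
  open Polynomials K
  open Apartness K card

  isField : IsFiniteField (HeytingCommutativeRing.commutativeRing heytingCommutativeRing) (suc (double m))
  isField = isFiniteField ≡.refl
  open QuinticRoots isField using (+≈0⇒≈; cube-injective; triples-cardinality; quintic-root; quintic-root-unique)

  triples : ∀ v₁ v₂ → v₁ # 0# → v₂ # 0# → v₁ # v₂ →
            ΔTriples v₁ v₂ HasCardinality (2 ℕ.^ (2 ℕ.* suc (double m) ℕ.∸ 3))
  triples v₁ v₂ v₁#0 v₂#0 v₁#v₂ =
    triples-cardinality v₁ v₂ (#⇒≉ v₁#0) (#⇒≉ v₂#0) (#⇒≉ v₁#v₂ ∘′ +≈0⇒≈)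

  unique-root : ∀ a b → a # 0# → a # 1# → (b#0 : b # 0#) → b # 1# → a ^ 6 + b ^ 6 ≈ 1# →
                HasDegree (quinticₚ a b) 15 × IsUniqueRoot (quinticₚ a b) (a / b [ b#0 ])
  unique-root a b a#0 a#1 b#0 _ a⁶+b⁶≈1 =
    (inverse⇒#0 (trans (*-congˡ (Leads.top leads)) (proj₂ (≉0⇒inverse a³+1≉0))) , Leads.above leads) ,
    trans (eval-quinticₚ a b _) (quintic-root (#⇒≉ a#0) (#⇒≉ b#0) a⁶+b⁶≈1 b⁻¹ b⁻¹b≈1) ,
    λ t root → quintic-root-unique (#⇒≉ a#0) (#⇒≉ b#0) a⁶+b⁶≈1 b⁻¹ b⁻¹b≈1 t
                 (trans (sym (eval-quinticₚ a b t)) root)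
    where
    leads : Leads (quinticₚ a b) 15 (a ^ 3 + 1#)
    leads = quinticₚ-leads a b
    b⁻¹ : Carrier
    b⁻¹ = proj₁ (#⇒invertible b#0)
    b⁻¹b≈1 : b⁻¹ * b ≈ 1#
    b⁻¹b≈1 = proj₂ (#0⇒inverse b#0)
    1³≈1 : 1# ^ 3 ≈ 1#
    1³≈1 = trans (*-identityˡ _) (trans (*-identityˡ _) (*-identityˡ 1#))
    -- Cubing is injective for odd n, so a ≠ 1 keeps the two leading coefficients from cancelling.
    a³+1≉0 : ¬ a ^ 3 + 1# ≈ 0#
    a³+1≉0 eq = #⇒≉ a#1 (cube-injective (trans (+≈0⇒≈ eq) (sym 1³≈1)))
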